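{- Let $g\in\mathcal{G}$ be $\mathbb{S}$-nearly periodic. Then either $g$ is not 1-pass tractable, or for every $\eta>0$ the function $L_\eta(g)$ is not 1-pass tractable, where $L_\eta(g)(x)=g(x)\log^\eta(1+x)$.
   Context: Streams: a stream of length $m$ with domain $[n]$ is a list $D=\langle (i_1,\delta_1),\dots,(i_m,\delta_m)\rangle$ with $i_j\in[n]$, $\delta_j\in\mathbb{Z}$; its frequency vector $V(D)=v\in\mathbb{Z}^n$ has $v_i=\sum_{j:i_j=i}\delta_j$. (Turnstile model) there is $M\in\mathbb{N}$ such that the frequency vector of $D$ and of every prefix of $D$ lies in $\{ -M,\dots,M\}^n$; throughout $M$ is polynomial in $n$. $\mathcal{D}(n,m)$ is the set of such streams with domain $[n]$ and length at most $m$. A $p$-pass algorithm reads the stream $p$ times in order and may use randomness. For $g:\mathbb{Z}_{\ge0}\to\mathbb{R}$ and $v\in\mathbb{Z}^n$ let $g(v)=\sum_{i=1}^n g(|v_i|)$. The problem $(g,\epsilon)$-SUM is to output $\hat G$ with $P\big((1-\epsilon)g(V(D))\le \hat G\le (1+\epsilon)g(V(D))\big)\ge 2/3$. A function $f:\mathbb{R}_{\ge0}\to\mathbb{R}_{\ge0}$ is sub-polynomial if for every $\alpha>0$, $\lim_{x\to\infty}x^\alpha f(x)=\infty$ and $\lim_{x\to\infty}x^{ -\alpha}f(x)=0$. $g$ is $p$-pass tractable if for every sub-polynomial $h$ and every $\epsilon\ge 1/h(nM)$ there exist a sub-polynomial $h^*$ and a $p$-pass algorithm (with oracle access to $g$)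 that solves $(g,\epsilon)$-SUM for all streams in $\mathcal{D}(n,m)$ and all $n,M\ge1$ using at most $h^*(nM)$ bits of space in the worst case. $\mathcal{G}=\{g:\mathbb{Z}_{\ge0}\to\mathbb{R}: g(0)=0,\ g(1)=1,\ g(x)>0\ \forall x>0\}$. For a set $\mathcal{S}$ of functions, $g$ is $\mathcal{S}$-nearly periodic if (1) there is $\alpha>0$ such that for every $N>0$ there exist $x,y\in\mathbb{N}$, $x<y$, $y\ge N$ with $g(y)\le g(x)/y^\alpha$ (such $y$ is called an $\alpha$-period of $g$); and (2) for every $\alpha>0$ and every $h\in\mathcal{S}$ there is $N_1>0$ such that for all $\alpha$-periods $y\ge N_1$ and all $x<y$ with $g(y)y^\alpha\le g(x)$, $|g(x+y)-g(x)|\le \min\{g(x),g(x+y)\}h(y)$. $\mathbb{S}$ denotes the set of non-increasing sub-polynomial functions on $\mathbb{Z}_{\ge0}$. -}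

module Defs where

open import Algebra.Bundles using (CommutativeRing; Semiring)
open import Data.Bool.Base using (Bool; if_then_else_)
open import Data.Empty using (⊥-elim)
open import Data.Fin.Base using (Fin)
import Data.Fin.Properties as Fin
import Data.Integer.Base as ℤ
open ℤ using (ℤ)
open import Data.List.Base using (List; []; _∷_; length; take; map; concatMap; allFin)
open import Data.List.Relation.Unary.All using (All)
open import Data.List.Relation.Unary.Unique.Propositional using (Unique)
import Data.Nat.Base as ℕ
open ℕ using (ℕ; zero; suc)
import Data.Nat.Properties as ℕ
open import Data.Product using (Σ; ∃; ∃-syntax; _×_; _,_; proj₁; proj₂)
open import Data.Sum.Base using (_⊎_; inj₁; inj₂)
open import Data.Vec.Base using (Vec; []; _∷_)
open import Level using (0ℓ) renaming (suc to lsuc)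
import Relation.Binary.Construct.StrictToNonStrict as StrictToNonStrict
open import Relation.Binary.Core using (Rel)
open import Relation.Binary.Definitions using (Tri; tri<; tri≈; tri>)
open import Relation.Binary.PropositionalEquality.Core as ≡ using (_≡_)
open import Relation.Binary.Structures using (IsStrictTotalOrder)
open import Relation.Nullary using (¬_; does; yes; no)
open import Relation.Unary using (Pred)

-- The classical axioms for ℝ, categorical up to isomorphism.  Existence
-- of suprema is stated for arbitrary predicates, and together with
-- trichotomy it yields excluded middle for propositions in Set.

record CompleteOrderedField : Set (lsuc 0ℓ) where
  field
    commutativeRing : CommutativeRing 0ℓ 0ℓ

  open CommutativeRing commutativeRing public
    renaming (Carrier to ℝ)

  infix  4 _<_
  infix  8 _⁻¹

  field
    _<_                : Rel ℝ 0ℓ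
    isStrictTotalOrder : IsStrictTotalOrder _≈_ _<_
    0<1                : 0# < 1#
    +-monoˡ-<          : ∀ z {x y} → x < y → x + z < y + z
    *-pos              : ∀ {x y} → 0# < x → 0# < y → 0# < x * y
    -- The value of 0# ⁻¹ is unconstrained.
    _⁻¹                : ℝ → ℝ
    ⁻¹-inverseʳ        : ∀ {x} → ¬ x ≈ 0# → x * x ⁻¹ ≈ 1#

  open StrictToNonStrict _≈_ _<_ public using (_≤_)

  UpperBound : Pred ℝ 0ℓ → ℝ → Set
  UpperBound P b = ∀ y → P y → y ≤ b

  IsSupremum : Pred ℝ 0ℓ → ℝ → Set
  IsSupremum P s = UpperBound P s × (∀ c → c < s → ∃[ y ] P y × c < y)

  field
    supremum : (P : Pred ℝ 0ℓ) → ∃ P → ∃ (UpperBound P) → ∃ (IsSupremum P)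

module RealArithmetic (R : CompleteOrderedField) where

  open CompleteOrderedField R public
  open IsStrictTotalOrder isStrictTotalOrder public
    using (compare; irrefl; asym; <-resp-≈; <-respʳ-≈; <-respˡ-≈)
    renaming (trans to <-trans)
  open import Algebra.Definitions.RawSemiring
    (Semiring.rawSemiring semiring) public
    using (sum) renaming (_×_ to _·_; _^_ to _^ℕ_)
  open import Algebra.Properties.Semiring.Mult semiring
    using (×-homo-+; ×1-homo-*)
  open import Algebra.Properties.Semiring.Exp semiring
    using (^-homo-*; ^-assocʳ)
  open import Algebra.Properties.Ring ring
    using (-‿distribˡ-*)
  private module NonStrict = StrictToNonStrict _≈_ _<_

  fromℕ : ℕ → ℝ
  fromℕ n = n · 1#

  ∣_∣ : ℝ → ℝ
  ∣ x ∣ with compare x 0#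
  ... | tri< _ _ _ = - x
  ... | tri≈ _ _ _ = x
  ... | tri> _ _ _ = x

  _⊓_ : ℝ → ℝ → ℝ
  x ⊓ y with compare x y
  ... | tri< _ _ _ = x
  ... | tri≈ _ _ _ = x
  ... | tri> _ _ _ = y

  infixl 7 _/_
  _/_ : ℝ → ℝ → ℝ
  x / y = x * y ⁻¹

  ≤-refl : ∀ {x} → x ≤ x
  ≤-refl = inj₂ refl

  ≤-trans : ∀ {x y z} → x ≤ y → y ≤ z → x ≤ z
  ≤-trans = NonStrict.trans isEquivalence <-resp-≈ <-trans

  <-≤-trans : ∀ {x y z} → x < y → y ≤ z → x < z
  <-≤-trans = NonStrict.<-≤-trans <-trans <-respʳ-≈

  ≤-<-trans : ∀ {x y z} → x ≤ y → y < z → x < z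
  ≤-<-trans = NonStrict.≤-<-trans sym <-trans <-respˡ-≈

  ≮⇒≥ : ∀ {x y} → ¬ x < y → y ≤ x
  ≮⇒≥ {x} {y} x≮y with compare x y
  ... | tri< x<y _ _ = ⊥-elim (x≮y x<y)
  ... | tri≈ _ x≈y _ = inj₂ (sym x≈y)
  ... | tri> _ _ y<x = inj₁ y<x

  ≤⇒≯ : ∀ {x y} → x ≤ y → ¬ y < x
  ≤⇒≯ x≤y y<x = irrefl refl (≤-<-trans x≤y y<x)

  +-monoʳ-< : ∀ z {x y} → x < y → z + x < z + y
  +-monoʳ-< z x<y =
    <-respˡ-≈ (+-comm _ z) (<-respʳ-≈ (+-comm _ z) (+-monoˡ-< z x<y))

  +-monoʳ-≤ : ∀ z {x y} → x ≤ y → z + x ≤ z + y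
  +-monoʳ-≤ z (inj₁ x<y) = inj₁ (+-monoʳ-< z x<y)
  +-monoʳ-≤ z (inj₂ x≈y) = inj₂ (+-congˡ x≈y)

  *-monoˡ-< : ∀ {z x y} → 0# < z → x < y → x * z < y * z
  *-monoˡ-< {z} {x} {y} 0<z x<y =
    <-respˡ-≈ (+-identityˡ _) (<-respʳ-≈ eq (+-monoˡ-< (x * z) pos))
    where
    pos : 0# < (y + - x) * z
    pos = *-pos (<-respˡ-≈ (-‿inverseʳ x) (+-monoˡ-< (- x) x<y)) 0<z
    eq : (y + - x) * z + x * z ≈ y * z
    eq = trans (sym (distribʳ z _ x))
      (*-congʳ (trans (+-assoc y _ x)
        (trans (+-congˡ (-‿inverseˡ x)) (+-identityʳ y))))

  *-monoˡ-≤ : ∀ {z x y} → 0# ≤ z → x ≤ y → x * z ≤ y * z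
  *-monoˡ-≤ (inj₁ 0<z) (inj₁ x<y) = inj₁ (*-monoˡ-< 0<z x<y)
  *-monoˡ-≤ (inj₂ 0≈z) (inj₁ _)   =
    inj₂ (trans (*-congˡ (sym 0≈z)) (trans (zeroʳ _)
      (trans (sym (zeroʳ _)) (*-congˡ 0≈z))))
  *-monoˡ-≤ _          (inj₂ x≈y) = inj₂ (*-congʳ x≈y)

  *-monoʳ-≤ : ∀ {z x y} → 0# ≤ z → x ≤ y → z * x ≤ z * y
  *-monoʳ-≤ 0≤z x≤y =
    ≤-trans (inj₂ (*-comm _ _)) (≤-trans (*-monoˡ-≤ 0≤z x≤y) (inj₂ (*-comm _ _)))

  *-monoʳ-< : ∀ {z x y} → 0# < z → x < y → z * x < z * y
  *-monoʳ-< 0<z x<y =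
    <-respˡ-≈ (*-comm _ _) (<-respʳ-≈ (*-comm _ _) (*-monoˡ-< 0<z x<y))

  0≤fromℕ : ∀ n → 0# ≤ fromℕ n
  0≤fromℕ zero    = ≤-refl
  0≤fromℕ (suc n) = ≤-trans (inj₁ 0<1)
    (≤-trans (inj₂ (sym (+-identityʳ 1#))) (+-monoʳ-≤ 1# (0≤fromℕ n)))

  1≤fromℕ[1+n] : ∀ n → 1# ≤ fromℕ (suc n)
  1≤fromℕ[1+n] n =
    ≤-trans (inj₂ (sym (+-identityʳ 1#))) (+-monoʳ-≤ 1# (0≤fromℕ n))

  fromℕ-mono-< : ∀ {m n} → m ℕ.< n → fromℕ m < fromℕ n
  fromℕ-mono-< {zero}  {suc n} _           = <-≤-trans 0<1 (1≤fromℕ[1+n] n)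
  fromℕ-mono-< {suc m} {suc n} (ℕ.s≤s m<n) = +-monoʳ-< 1# (fromℕ-mono-< m<n)

  fromℕ-cancel-≤ : ∀ {m n} → fromℕ m ≤ fromℕ n → m ℕ.≤ n
  fromℕ-cancel-≤ m≤n = ℕ.≮⇒≥ λ n<m → ≤⇒≯ m≤n (fromℕ-mono-< n<m)

  archimedean : ∀ x → ∃[ N ] x ≤ fromℕ N
  archimedean x with compare x 0#
  ... | tri< x<0 _ _ = 0 , inj₁ x<0
  ... | tri≈ _ x≈0 _ = 0 , inj₂ x≈0
  ... | tri> _ _ 0<x with supremum (λ y → ∃[ n ] y ≡ fromℕ n × y ≤ x)
                             (0# , 0 , ≡.refl , inj₁ 0<x)
                             (x , λ { _ (_ , _ , y≤x) → y≤x })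
  ...   | s , ub , approx with approx (- 1# + s) below
    where
    below : - 1# + s < s
    below = <-respʳ-≈ (trans (sym (+-assoc _ 1# s))
                        (trans (+-congʳ (-‿inverseˡ 1#)) (+-identityˡ s)))
              (+-monoʳ-< (- 1#) (<-respˡ-≈ (+-identityˡ s) (+-monoˡ-< s 0<1)))
  ...     | _ , (n , ≡.refl , _) , s-1<n = suc n , ≮⇒≥ absurd
    where
    s<1+n : s < fromℕ (suc n)
    s<1+n = <-respˡ-≈ (trans (sym (+-assoc 1# _ s))
                        (trans (+-congʳ (-‿inverseʳ 1#)) (+-identityˡ s)))
              (+-monoʳ-< 1# s-1<n)
    absurd : ¬ fromℕ (suc n) < x
    absurd 1+n<x = ≤⇒≯ (ub _ (suc n , ≡.refl , inj₁ 1+n<x)) s<1+n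

  1≤^ℕ : ∀ {a} n → 1# ≤ a → 1# ≤ a ^ℕ n
  1≤^ℕ zero    1≤a = ≤-refl
  1≤^ℕ {a} (suc n) 1≤a = ≤-trans 1≤a
    (≤-trans (inj₂ (sym (*-identityʳ a)))
      (*-monoʳ-≤ (≤-trans (inj₁ 0<1) 1≤a) (1≤^ℕ n 1≤a)))

  ^ℕ-monoʳ-≤ : ∀ {a m n} → 1# ≤ a → m ℕ.≤ n → a ^ℕ m ≤ a ^ℕ n
  ^ℕ-monoʳ-≤ {n = n} 1≤a ℕ.z≤n       = 1≤^ℕ n 1≤a
  ^ℕ-monoʳ-≤         1≤a (ℕ.s≤s m≤n) =
    *-monoʳ-≤ (≤-trans (inj₁ 0<1) 1≤a) (^ℕ-monoʳ-≤ 1≤a m≤n)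

  0<^ℕ : ∀ {a} n → 0# < a → 0# < a ^ℕ n
  0<^ℕ zero    0<a = 0<1
  0<^ℕ (suc n) 0<a = *-pos 0<a (0<^ℕ n 0<a)

  ^ℕ-monoˡ-< : ∀ {a b} n → 0# < a → a < b → a ^ℕ suc n < b ^ℕ suc n
  ^ℕ-monoˡ-< zero    0<a a<b = *-monoˡ-< 0<1 a<b
  ^ℕ-monoˡ-< (suc n) 0<a a<b = <-trans
    (*-monoˡ-< (0<^ℕ (suc n) 0<a) a<b)
    (*-monoʳ-< (<-trans 0<a a<b) (^ℕ-monoˡ-< n 0<a a<b))

  1^ℕ≈1 : ∀ n → 1# ^ℕ n ≈ 1#
  1^ℕ≈1 zero    = refl
  1^ℕ≈1 (suc n) = trans (*-identityˡ _) (1^ℕ≈1 n)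

  1≤x⁻¹ : ∀ {x} → 0# < x → x < 1# → 1# ≤ x ⁻¹
  1≤x⁻¹ {x} 0<x x<1 = ≮⇒≥ λ x⁻¹<1 → irrefl refl
    (<-trans (<-respˡ-≈ (⁻¹-inverseʳ (λ x≈0 → irrefl (sym x≈0) 0<x))
               (<-respʳ-≈ (*-identityʳ x) (*-monoʳ-< 0<x x⁻¹<1))) x<1)

  -- RationalPowers a α = { y ≥ 0 ∣ y ≤ a^(p/q) for some 0 ≤ p/q ≤ α }

  RationalPowers : ℝ → ℝ → Pred ℝ 0ℓ
  RationalPowers a α y = 0# ≤ y ×
    ∃[ p ] ∃[ q ] fromℕ p ≤ fromℕ (suc q) * α × y ^ℕ suc q ≤ a ^ℕ p

  one∈RationalPowers : ∀ a {α} → 0# ≤ α → RationalPowers a α 1#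
  one∈RationalPowers a 0≤α = inj₁ 0<1 , 0 , 0 ,
    ≤-trans 0≤α (inj₂ (sym (trans (*-congʳ (+-identityʳ 1#)) (*-identityˡ _)))) ,
    inj₂ (*-identityˡ 1#)

  RationalPowers-bounded : ∀ {a} α → 1# ≤ a → ∃ (UpperBound (RationalPowers a α))
  RationalPowers-bounded {a} α 1≤a with archimedean α
  ... | N , α≤N = a ^ℕ N , bound
    where
    bound : UpperBound (RationalPowers a α) (a ^ℕ N)
    bound y (_ , p , q , p≤qα , y^q≤a^p) = ≮⇒≥ λ a^N<y → ≤⇒≯
      (≤-trans y^q≤a^p (≤-trans (^ℕ-monoʳ-≤ 1≤a p≤Nq)
        (inj₂ (sym (^-assocʳ a N (suc q))))))
      (^ℕ-monoˡ-< q (0<^ℕ N (<-≤-trans 0<1 1≤a)) a^N<y)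
      where
      p≤Nq : p ℕ.≤ N ℕ.* suc q
      p≤Nq = fromℕ-cancel-≤ (≤-trans p≤qα
        (≤-trans (*-monoʳ-≤ (0≤fromℕ (suc q)) α≤N)
          (inj₂ (trans (*-comm _ _) (sym (×1-homo-* N (suc q)))))))

  pow≥1-sup : ∀ {a α} → 1# ≤ a → 0# ≤ α → ∃ (IsSupremum (RationalPowers a α))
  pow≥1-sup {a} {α} 1≤a 0≤α = supremum (RationalPowers a α)
    (1# , one∈RationalPowers a 0≤α) (RationalPowers-bounded α 1≤a)

  -- a^α = sup { a^r ∣ r rational, 0 ≤ r ≤ α }   for a ≥ 1, α ≥ 0
  pow≥1 : ∀ {a α} → 1# ≤ a → 0# ≤ α → ℝ
  pow≥1 1≤a 0≤α = proj₁ (pow≥1-sup 1≤a 0≤α)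

  -‿pos : ∀ {x} → x < 0# → 0# < - x
  -‿pos {x} x<0 = <-respˡ-≈ (-‿inverseʳ x) (<-respʳ-≈ (+-identityˡ _) (+-monoˡ-< (- x) x<0))

  pow≥1± : ∀ {a α} → 1# ≤ a → Tri (α < 0#) (α ≈ 0#) (0# < α) → ℝ
  pow≥1± 1≤a (tri< α<0 _ _) = pow≥1 1≤a (inj₁ (-‿pos α<0)) ⁻¹
  pow≥1± 1≤a (tri≈ _ α≈0 _) = pow≥1 1≤a (inj₂ (sym α≈0))
  pow≥1± 1≤a (tri> _ _ 0<α) = pow≥1 1≤a (inj₁ 0<α)

  powBy : ∀ a α → Tri (a < 0#) (a ≈ 0#) (0# < a) → Tri (a < 1#) (a ≈ 1#) (1# < a) → ℝ
  powBy a α (tri< _ _ _)   _              = 0#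
  powBy a α (tri≈ _ _ _)   _              = 0#
  powBy a α (tri> _ _ 0<a) (tri< a<1 _ _) = pow≥1± (1≤x⁻¹ 0<a a<1) (compare α 0#) ⁻¹
  powBy a α (tri> _ _ _)   (tri≈ _ a≈1 _) = pow≥1± (inj₂ (sym a≈1)) (compare α 0#)
  powBy a α (tri> _ _ _)   (tri> _ _ 1<a) = pow≥1± (inj₁ 1<a) (compare α 0#)

  -- The usual real power for a > 0 and for a = 0, α > 0; zero otherwise.
  infixr 8 _^_
  _^_ : ℝ → ℝ → ℝ
  a ^ α = powBy a α (compare a 0#) (compare a 1#)

  1≤2 : 1# ≤ fromℕ 2
  1≤2 = 1≤fromℕ[1+n] 1

  LogCandidates : ℝ → Pred ℝ 0ℓ
  LogCandidates a r = Σ (0# ≤ r) λ 0≤r → pow≥1 1≤2 0≤r ≤ a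

  zero∈LogCandidates : ∀ {a} → 1# ≤ a → LogCandidates a 0#
  zero∈LogCandidates 1≤a = ≤-refl , ≤-trans (≮⇒≥ 1≮2^0) 1≤a
    where
    1≮2^0 : ¬ 1# < pow≥1 1≤2 ≤-refl
    1≮2^0 1<2^0 with proj₂ (proj₂ (pow≥1-sup 1≤2 ≤-refl)) 1# 1<2^0
    ... | y , (_ , zero  , q , _ , y^q≤1) , 1<y =
      ≤⇒≯ y^q≤1 (<-respˡ-≈ (1^ℕ≈1 (suc q)) (^ℕ-monoˡ-< q 0<1 1<y))
    ... | y , (_ , suc p , q , p≤q0 , _) , _ =
      ≤⇒≯ (≤-trans p≤q0 (inj₂ (zeroʳ _))) (fromℕ-mono-< {n = suc p} (ℕ.s≤s ℕ.z≤n))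

  fromℕ≤2^ : ∀ n → fromℕ n ≤ fromℕ 2 ^ℕ n
  fromℕ≤2^ zero    = inj₁ 0<1
  fromℕ≤2^ (suc n) = ≤-trans (+-monoʳ-≤ 1# (fromℕ≤2^ n))
    (≤-trans (inj₂ (+-comm _ _)) (≤-trans (+-monoʳ-≤ _ (1≤^ℕ n 1≤2)) (inj₂ double)))
    where
    double : fromℕ 2 ^ℕ n + fromℕ 2 ^ℕ n ≈ fromℕ 2 * fromℕ 2 ^ℕ n
    double = sym (trans (distribʳ _ 1# _) (+-cong (*-identityˡ _)
      (trans (*-congʳ (+-identityʳ 1#)) (*-identityˡ _))))

  LogCandidates-bounded : ∀ a → ∃ (UpperBound (LogCandidates a))
  LogCandidates-bounded a with archimedean a
  ... | N , a≤N = fromℕ (suc N) , λ r (0≤r , 2^r≤a) → ≮⇒≥ λ 1+N<r → ≤⇒≯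
      (≤-trans (proj₁ (proj₂ (pow≥1-sup 1≤2 0≤r)) (fromℕ 2 ^ℕ suc N)
        ( inj₁ (0<^ℕ (suc N) (<-≤-trans 0<1 1≤2)) , suc N , 0
        , ≤-trans (inj₁ 1+N<r)
            (inj₂ (sym (trans (*-congʳ (+-identityʳ 1#)) (*-identityˡ _))))
        , inj₂ (*-identityʳ _)))
        (≤-trans 2^r≤a a≤N))
      (<-≤-trans (fromℕ-mono-< (ℕ.n<1+n N)) (fromℕ≤2^ (suc N)))

  log₂-sup : ∀ {a} → 1# ≤ a → ∃ (IsSupremum (LogCandidates a))
  log₂-sup {a} 1≤a = supremum (LogCandidates a)
    (0# , zero∈LogCandidates 1≤a) (LogCandidates-bounded a)

  -- log₂ a = sup { r ≥ 0 ∣ 2^r ≤ a }   for a ≥ 1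
  log₂ : ∀ {a} → 1# ≤ a → ℝ
  log₂ 1≤a = proj₁ (log₂-sup 1≤a)

-- (i , δ) adds δ to the i-th coordinate of the frequency vector.
Update : ℕ → Set
Update n = Fin n × ℤ

Stream : ℕ → Set
Stream n = List (Update n)

frequency : ∀ {n} → Stream n → Fin n → ℤ
frequency []            i = ℤ.0ℤ
frequency ((j , δ) ∷ D) i =
  (if does (j Fin.≟ i) then δ else ℤ.0ℤ) ℤ.+ frequency D i

-- 𝒟 M m D : D has length at most m and obeys the turnstile bound M.
-- The prefixes of D, including D itself, are the lists take k D.
𝒟 : ∀ {n} → (M m : ℕ) → Stream n → Set
𝒟 M m D = length D ℕ.≤ m × (∀ k i → ℤ.∣ frequency (take k D) i ∣ ℕ.≤ M)

-- P(E) ≥ a / b for the uniform distribution on Fin K ^ ℓ: some set of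
-- pairwise distinct outcomes inside E has at least (a / b) * K ^ ℓ elements.
Probability≥ : ∀ {K ℓ} (a b : ℕ) → Pred (Vec (Fin K) ℓ) 0ℓ → Set
Probability≥ {K} {ℓ} a b E =
  ∃[ outcomes ] Unique outcomes × All E outcomes ×
    a ℕ.* K ℕ.^ ℓ ℕ.≤ b ℕ.* length outcomes

module Streaming (R : CompleteOrderedField) where

  open RealArithmetic R public

  -- A p-pass algorithm on domain [n] using `space` bits of memory.  It draws
  -- fresh uniform randomness from Fin (suc k) when starting, on reading each
  -- update, and when producing its output; a draw that is needed again later
  -- must be kept in memory.  The transition maps are arbitrary functions, so
  -- they may depend on n, on M, and on g (the oracle).
  record Algorithm (p n : ℕ) : Set where
    field
      space  : ℕ
      k      : ℕ

    Draw : Set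
    Draw = Fin (suc k)

    Memory : Set
    Memory = Vec Bool space

    field
      init   : Draw → Memory
      step   : Fin p → Update n → Draw → Memory → Memory
      output : Draw → Memory → ℝ

    input : Stream n → List (Fin p × Update n)
    input D = concatMap (λ pass → map (pass ,_) D) (allFin p)

    process : (w : List (Fin p × Update n)) → Vec Draw (length w) → Memory → Memory
    process []              []       s = s
    process ((pass , u) ∷ w) (d ∷ ds) s = process w ds (step pass u d s)

    run : (D : Stream n) → Vec Draw (2 ℕ.+ length (input D)) → ℝ
    run D (d₀ ∷ d₁ ∷ ds) = output d₁ (process (input D) ds (init d₀))

  gSum : (ℕ → ℝ) → ∀ {n} → (Fin n → ℤ) → ℝ
  gSum g v = sum (λ i → g ℤ.∣ v i ∣)

  SolvesSum : ∀ {p n} → (ℕ → ℝ) → ℝ → Algorithm p n → Stream n → Set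
  SolvesSum g ε A D = Probability≥ 2 3 λ ω →
    (1# - ε) * gSum g (frequency D) ≤ Algorithm.run A D ω ×
    Algorithm.run A D ω ≤ (1# + ε) * gSum g (frequency D)

  -- Domain is ℝ≥0 or ℕ, and ι its inclusion into ℝ.
  record IsSubPolynomial {Domain : Set} (ι : Domain → ℝ) (f : Domain → ℝ) : Set where
    field
      cong        : ∀ {x y} → ι x ≈ ι y → f x ≈ f y
      nonNegative : ∀ x → 0# ≤ f x
      x^αf→∞      : ∀ α → 0# < α → ∀ B → ∃[ X ] ∀ x → X ≤ ι x →
                    B ≤ ι x ^ α * f x
      x^-αf→0     : ∀ α → 0# < α → ∀ δ → 0# < δ → ∃[ X ] ∀ x → X ≤ ι x →
                    ∣ ι x ^ (- α) * f x ∣ < δ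

  ℝ≥0 : Set
  ℝ≥0 = ∃[ x ] 0# ≤ x

  SubPolynomial : (ℝ≥0 → ℝ) → Set
  SubPolynomial = IsSubPolynomial proj₁

  fromℕ≥0 : ℕ → ℝ≥0
  fromℕ≥0 n = fromℕ n , 0≤fromℕ n

  𝕊 : Pred (ℕ → ℝ) 0ℓ
  𝕊 h = IsSubPolynomial fromℕ h × (∀ {m n} → m ℕ.≤ n → h n ≤ h m)

  -- The accuracy ε is a function of n and M, since it is bounded below by
  -- 1 / h(nM).  That bound is written 1 ≤ ε h(nM), which fails if h(nM) = 0,
  -- as it should for 1 / 0 = ∞.
  Tractable : (p : ℕ) → (ℕ → ℝ) → Set
  Tractable p g =
    ∀ (h : ℝ≥0 → ℝ) → SubPolynomial h →
    ∀ (ε : ℕ → ℕ → ℝ) →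
    (∀ n M → 1 ℕ.≤ n → 1 ℕ.≤ M → 1# ≤ ε n M * h (fromℕ≥0 (n ℕ.* M))) →
    Σ (ℝ≥0 → ℝ) λ h* → SubPolynomial h* ×
    Σ (∀ n M → Algorithm p n) λ A →
      ∀ n M → 1 ℕ.≤ n → 1 ℕ.≤ M →
      fromℕ (Algorithm.space (A n M)) ≤ h* (fromℕ≥0 (n ℕ.* M)) ×
      (∀ m D → 𝒟 M m D → SolvesSum g (ε n M) (A n M) D)

  𝒢 : Pred (ℕ → ℝ) 0ℓ
  𝒢 g = g 0 ≈ 0# × g 1 ≈ 1# × (∀ x → 0 ℕ.< x → 0# < g x)

  IsPeriod : (ℕ → ℝ) → ℝ → ℕ → Set
  IsPeriod g α y = ∃[ x ] x ℕ.< y × g y ≤ g x / fromℕ y ^ α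

  record NearlyPeriodic (𝒮 : Pred (ℕ → ℝ) 0ℓ) (g : ℕ → ℝ) : Set where
    field
      unboundedPeriods : ∃[ α ] 0# < α ×
        (∀ N → 0 ℕ.< N → ∃[ y ] N ℕ.≤ y × IsPeriod g α y)
      almostRepeats : ∀ α → 0# < α → ∀ h → 𝒮 h → ∃[ N₁ ] 0 ℕ.< N₁ ×
        (∀ y → N₁ ℕ.≤ y → IsPeriod g α y →
         ∀ x → x ℕ.< y → g y * fromℕ y ^ α ≤ g x →
         ∣ g (x ℕ.+ y) - g x ∣ ≤ (g x ⊓ g (x ℕ.+ y)) * h y)

  -- Base 2 makes L η g 1 ≈ 1#, so that L η maps 𝒢 to 𝒢.
  L : ℝ → (ℕ → ℝ) → (ℕ → ℝ)
  L η g x = g x * log₂ (1≤fromℕ[1+n] x) ^ η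

{-# OPTIONS --safe #-}

-- Passing from g to f = L η g always destroys tractability.  At a period y with
-- witness x the value f y is polynomially smaller than f x, but f (x + y) and f x
-- cannot agree: g (x + y) and g x agree up to a factor 1 ± u, where near periodicity
-- makes u as small a multiple of 1 / log y as we wish, while 1 + x + y ≥ 2 (1 + x)
-- forces log (1 + x + y) ≥ log (1 + x) + 1, so log^η grows by a factor 1 + c / log y.
-- A one-pass algorithm for f with accuracy of order 1 / log (n M) therefore solves
-- INDEX: Alice inserts y copies of each i in her set, Bob adds x copies of the item b
-- he asks about, and the total is close to f (x + y) or to f x according to whether b
-- is in the set, the other coordinates contributing at most n f y, which is negligible
-- for n a small power of y.  INDEX needs linear space, and n is polynomial in n M.
module Submission where

open import Defs
open import Data.Bool.Base using (Bool; true; false; if_then_else_)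
open import Data.Fin.Base using (Fin; zero; suc)
import Data.Fin.Properties as Fin
open import Data.Integer.Base as ℤ using ()
open import Data.List.Base using (List; []; _∷_; length; map; _++_; take; drop; cartesianProductWith; allFin)
open import Data.List.Properties
  using (length-++; length-map; length-tabulate; map-++; map-∘; map-cong; ++-identityʳ; take-map)
open import Data.List.Membership.Propositional using (_∈_)
open import Data.List.Membership.Propositional.Properties
  using (∈-∃++; ∈-++⁻; ∈-++⁺ˡ; ∈-++⁺ʳ; ∈-cartesianProductWith⁺; ∈-allFin)
open import Data.List.Relation.Unary.All as All using (All; []; _∷_)
open import Data.List.Relation.Unary.AllPairs using ([]; _∷_)
open import Data.List.Relation.Unary.Any using (here; there)
open import Data.List.Relation.Unary.Unique.Propositional using (Unique)
open import Data.List.Relation.Unary.Unique.Propositional.Properties using (allFin⁺)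
open import Data.Nat.Base as ℕ using (ℕ; zero; suc; z≤n; s≤s)
open import Data.Nat.DivMod using (m≡m%n+[m/n]*n; m%n<n)
import Data.Nat.ListAction
import Data.Nat.Properties as ℕ
open import Data.Nat.Solver using (module +-*-Solver)
open import Data.Product.Base using (_,_; _×_; ∃-syntax; proj₁; proj₂)
open import Data.Sum.Base using (_⊎_; inj₁; inj₂)
open import Data.Vec.Base using (Vec; []; _∷_; lookup; toList)
open import Function.Base using (_∘_)
open import Level using (0ℓ)
open import Relation.Binary.Definitions using (tri<; tri≈; tri>)
open import Relation.Binary.PropositionalEquality as ≡ using (_≡_; _≢_; cong; subst; module ≡-Reasoning)
open import Relation.Binary.Structures using (IsStrictTotalOrder)
open import Relation.Nullary using (¬_)
open import Relation.Nullary.Decidable using (does; yes; no; dec-true; dec-false; toWitness)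
open import Relation.Nullary.Negation using (contradiction)
open import Relation.Unary using (Pred)
import Algebra.Properties.CommutativeSemiring.Exp
import Algebra.Properties.Semiring.Exp
import Algebra.Properties.Semiring.Mult
import Algebra.Solver.Ring.NaturalCoefficients.Default
import Relation.Binary.Construct.StrictToNonStrict as StrictToNonStrict
import Relation.Binary.Reasoning.Base.Triple

-- The delicate point is calibration. Near periodicity is invoked at a precision `u` that must be a
-- non-increasing sub-polynomial function of `y` alone, yet small against the growth of `log^η`; the
-- accuracy `ε` must be a function of `n` and `M`, fixed before the algorithm is known. Both are
-- therefore reciprocals of `logarithmic`, a constant times one plus a bit length. With
-- `suc Q * η ≥ 1` and `c = 3 ^ suc Q`, the estimate `(1 + v) ^ suc Q ≤ 1 + c * v` converts one unit
-- of logarithm into a factor `1 + 4 * u` of its `η`-th power; `g` loses at most a factor `1 - u`,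
-- and the net gain `1 + 2 * u` leaves room for `ε ≤ u / 4`. The bound for INDEX comes from
-- counting, not from entropy: success probability 2/3 on each of `3 * k` bits forces
-- `32 ^ k ≤ 2 ^ s * 27 ^ k`, and `2 * 27 ^ 5 ≤ 32 ^ 5` turns this into `s ≥ 2 ^ i` for `15 * 2 ^ i`
-- bits. On the other side `n * M` stays below a fixed power of `2 ^ i`, so sub-polynomial space
-- eventually drops below `2 ^ i`.

-- Exponentials against polynomials in the natural numbers.

n<2^n : ∀ n → n ℕ.< 2 ℕ.^ n
n<2^n zero    = s≤s z≤n
n<2^n (suc n) = begin-strict
  1 ℕ.+ n            <⟨ ℕ.+-monoʳ-< 1 (n<2^n n) ⟩
  1 ℕ.+ 2 ℕ.^ n      ≤⟨ ℕ.+-monoˡ-≤ (2 ℕ.^ n) (ℕ.m^n>0 2 n) ⟩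
  2 ℕ.^ n ℕ.+ 2 ℕ.^ n  ≡⟨ ≡.cong (2 ℕ.^ n ℕ.+_) (ℕ.+-identityʳ _) ⟨
  2 ℕ.^ suc n      ∎
  where open ℕ.≤-Reasoning

^-distribʳ-* : ∀ k m n → (m ℕ.* n) ℕ.^ k ≡ m ℕ.^ k ℕ.* n ℕ.^ k
^-distribʳ-* zero    m n = ≡.refl
^-distribʳ-* (suc k) m n = ≡.trans (≡.cong (m ℕ.* n ℕ.*_) (^-distribʳ-* k m n))
  (ℕ.[m*n]*[o*p]≡[m*o]*[n*p] m n (m ℕ.^ k) (n ℕ.^ k))

-- Division of `k - 1` by `suc q`. The left inequality is strict because `k` will be a bit length,
-- for which `j < k` is what gives `2 ^ j ≤ t`.
block : ∀ q {i₀ k} → suc q ℕ.* i₀ ℕ.< k →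
  ∃[ i ] i₀ ℕ.≤ i × suc q ℕ.* i ℕ.< k × k ℕ.≤ suc q ℕ.* suc i
block q {i₀} {suc k} (s≤s qi₀≤k) = i , i₀≤i , s≤s qi≤k , k<q[1+i]
  where
  i = k ℕ./ suc q
  open ℕ.≤-Reasoning
  qi≤k : suc q ℕ.* i ℕ.≤ k
  qi≤k = begin
    suc q ℕ.* i                  ≡⟨ ℕ.*-comm (suc q) i ⟩
    i ℕ.* suc q                  ≤⟨ ℕ.m≤n+m _ (k ℕ.% suc q) ⟩
    k ℕ.% suc q ℕ.+ i ℕ.* suc q  ≡⟨ m≡m%n+[m/n]*n k (suc q) ⟨
    k                            ∎
  k<q[1+i] : k ℕ.< suc q ℕ.* suc i
  k<q[1+i] = begin-strict
    k                            ≡⟨ m≡m%n+[m/n]*n k (suc q) ⟩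
    k ℕ.% suc q ℕ.+ i ℕ.* suc q  <⟨ ℕ.+-monoˡ-< (i ℕ.* suc q) (m%n<n k (suc q)) ⟩
    suc i ℕ.* suc q              ≡⟨ ℕ.*-comm (suc i) (suc q) ⟩
    suc q ℕ.* suc i              ∎
  i₀≤i : i₀ ℕ.≤ i
  i₀≤i = ℕ.≤-pred (ℕ.*-cancelˡ-< (suc q) i₀ (suc i) (ℕ.≤-<-trans qi₀≤k k<q[1+i]))

-- If `suc i` lies in block `m` of length `suc d`, then `suc i ≤ suc d * suc m ≤ suc d * 2 ^ m`;
-- raised to the power `suc d`, the last factor is at most `2 ^ i`.
[1+i]^d≤d^d*2^i : ∀ d i → suc i ℕ.^ suc d ℕ.≤ suc d ℕ.^ suc d ℕ.* 2 ℕ.^ i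
[1+i]^d≤d^d*2^i d i with block d {0} {suc i} (≡.subst (ℕ._< suc i) (≡.sym (ℕ.*-zeroʳ (suc d))) (s≤s z≤n))
... | m , _ , s≤s dm≤i , i<d[1+m] = begin
  suc i ℕ.^ suc d                          ≤⟨ ℕ.^-monoˡ-≤ (suc d) (ℕ.≤-trans i<d[1+m] (ℕ.*-monoʳ-≤ (suc d) (n<2^n m))) ⟩
  (suc d ℕ.* 2 ℕ.^ m) ℕ.^ suc d            ≡⟨ ^-distribʳ-* (suc d) (suc d) (2 ℕ.^ m) ⟩
  suc d ℕ.^ suc d ℕ.* (2 ℕ.^ m) ℕ.^ suc d  ≡⟨ ≡.cong (suc d ℕ.^ suc d ℕ.*_) (ℕ.^-*-assoc 2 m (suc d)) ⟩
  suc d ℕ.^ suc d ℕ.* 2 ℕ.^ (m ℕ.* suc d)  ≤⟨ ℕ.*-monoʳ-≤ (suc d ℕ.^ suc d) (ℕ.^-monoʳ-≤ 2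
                                               (ℕ.≤-trans (ℕ.≤-reflexive (ℕ.*-comm m (suc d))) dm≤i)) ⟩
  suc d ℕ.^ suc d ℕ.* 2 ℕ.^ i              ∎
  where open ℕ.≤-Reasoning

-- The previous bound is used with one degree to spare: the extra factor `suc i` pays for `c * e`,
-- after which `e` cancels.
polynomial≤2^ : ∀ c d → ∃[ i₀ ] ∀ i → i₀ ℕ.≤ i → c ℕ.* suc i ℕ.^ d ℕ.≤ 2 ℕ.^ i
polynomial≤2^ c d = c ℕ.* e , λ i ce≤i → ℕ.*-cancelˡ-≤ e {{ℕ.m^n≢0 (suc d) (suc d)}} (begin
  e ℕ.* (c ℕ.* suc i ℕ.^ d)  ≡⟨ ℕ.*-assoc e c _ ⟨
  e ℕ.* c ℕ.* suc i ℕ.^ d    ≡⟨ ≡.cong (ℕ._* suc i ℕ.^ d) (ℕ.*-comm e c) ⟩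
  c ℕ.* e ℕ.* suc i ℕ.^ d    ≤⟨ ℕ.*-monoˡ-≤ (suc i ℕ.^ d) (ℕ.m≤n⇒m≤1+n ce≤i) ⟩
  suc i ℕ.* suc i ℕ.^ d      ≤⟨ [1+i]^d≤d^d*2^i d i ⟩
  e ℕ.* 2 ℕ.^ i              ∎)
  where
  e = suc d ℕ.^ suc d
  open ℕ.≤-Reasoning

-- The communication lower bound for INDEX by counting.

module Counting where

  open import Data.Nat.Base
  open import Data.Nat.Properties
  open import Data.Nat.ListAction using (sum)
  open import Data.Nat.ListAction.Properties using (sum-++)
  open +-*-Solver using (solve; con; _:+_; _:*_; _:=_)
  open ≡ using (refl; sym; trans; cong₂)

  private variable
    A B C : Set

  sumOver : List A → (A → ℕ) → ℕ
  sumOver xs f = sum (map f xs)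

  sumOver-mono : ∀ (xs : List A) {f g} → (∀ x → f x ≤ g x) → sumOver xs f ≤ sumOver xs g
  sumOver-mono []       f≤g = z≤n
  sumOver-mono (x ∷ xs) f≤g = +-mono-≤ (f≤g x) (sumOver-mono xs f≤g)

  sumOver-cong : ∀ (xs : List A) {f g} → (∀ x → f x ≡ g x) → sumOver xs f ≡ sumOver xs g
  sumOver-cong xs f≡g = cong sum (map-cong f≡g xs)

  sumOver-const : ∀ (xs : List A) c → sumOver xs (λ _ → c) ≡ length xs * c
  sumOver-const []       c = refl
  sumOver-const (_ ∷ xs) c = cong (c +_) (sumOver-const xs c)

  sumOver-+ : ∀ (xs : List A) f g → sumOver xs (λ x → f x + g x) ≡ sumOver xs f + sumOver xs g
  sumOver-+ []       f g = refl
  sumOver-+ (x ∷ xs) f g = trans (cong (f x + g x +_) (sumOver-+ xs f g))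
    (solve 4 (λ a b c d → (a :+ b) :+ (c :+ d) := (a :+ c) :+ (b :+ d)) refl (f x) (g x) _ _)

  sumOver-* : ∀ (xs : List A) c f → sumOver xs (λ x → c * f x) ≡ c * sumOver xs f
  sumOver-* []       c f = sym (*-zeroʳ c)
  sumOver-* (x ∷ xs) c f = trans (cong (c * f x +_) (sumOver-* xs c f)) (sym (*-distribˡ-+ c (f x) _))

  sumOver-swap : ∀ (xs : List A) (ys : List B) (f : A → B → ℕ) →
    sumOver xs (λ x → sumOver ys (f x)) ≡ sumOver ys (λ y → sumOver xs (λ x → f x y))
  sumOver-swap []       ys f = sym (trans (sumOver-const ys 0) (*-zeroʳ (length ys)))
  sumOver-swap (x ∷ xs) ys f = trans (cong (sumOver ys (f x) +_) (sumOver-swap xs ys f))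
    (sym (sumOver-+ ys (f x) _))

  ∈⇒≤sumOver : ∀ {xs : List A} {x} f → x ∈ xs → f x ≤ sumOver xs f
  ∈⇒≤sumOver f (here refl) = m≤m+n _ _
  ∈⇒≤sumOver f (there x∈)  = ≤-trans (∈⇒≤sumOver f x∈) (m≤n+m _ _)

  sumOver-++ : ∀ (xs ys : List A) f → sumOver (xs ++ ys) f ≡ sumOver xs f + sumOver ys f
  sumOver-++ xs ys f = trans (cong sum (map-++ f xs ys)) (sum-++ (map f xs) (map f ys))

  -- Each element of `xs` is matched with an occurrence in `ys`, which is then removed; distinctness
  -- guarantees that no later element needs the same occurrence.
  sumOver-⊆ : ∀ {xs ys : List A} f → Unique xs → (∀ {x} → x ∈ xs → x ∈ ys) → sumOver xs f ≤ sumOver ys f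
  sumOver-⊆ {xs = []} f _ _ = z≤n
  sumOver-⊆ {xs = x ∷ xs} f (x∉xs ∷ xs!) xs⊆ys with ∈-∃++ (xs⊆ys (here refl))
  ... | us , vs , refl = begin
    f x + sumOver xs f                    ≤⟨ +-monoʳ-≤ (f x) (sumOver-⊆ f xs! xs⊆us++vs) ⟩
    f x + sumOver (us ++ vs) f            ≡⟨ cong (f x +_) (sumOver-++ us vs f) ⟩
    f x + (sumOver us f + sumOver vs f)
      ≡⟨ solve 3 (λ a b c → a :+ (b :+ c) := b :+ (a :+ c)) refl (f x) (sumOver us f) (sumOver vs f) ⟩
    sumOver us f + (f x + sumOver vs f)   ≡⟨ sumOver-++ us (x ∷ vs) f ⟨
    sumOver (us ++ x ∷ vs) f              ∎
    where
    open ≤-Reasoning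
    xs⊆us++vs : ∀ {z} → z ∈ xs → z ∈ us ++ vs
    xs⊆us++vs z∈xs with ∈-++⁻ us (xs⊆ys (there z∈xs))
    ... | inj₁ z∈us         = ∈-++⁺ˡ z∈us
    ... | inj₂ (here refl)  = contradiction refl (All.lookup x∉xs z∈xs)
    ... | inj₂ (there z∈vs) = ∈-++⁺ʳ us z∈vs

  length-cartesianProductWith : ∀ (op : A → B → C) xs ys →
    length (cartesianProductWith op xs ys) ≡ length xs * length ys
  length-cartesianProductWith op []       ys = refl
  length-cartesianProductWith op (x ∷ xs) ys = trans (length-++ (map (op x) ys))
    (cong₂ _+_ (length-map (op x) ys) (length-cartesianProductWith op xs ys))

  vectors : List A → ∀ n → List (Vec A n)
  vectors xs zero    = [] ∷ []
  vectors xs (suc n) = cartesianProductWith _∷_ xs (vectors xs n)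

  length-vectors : ∀ (xs : List A) n → length (vectors xs n) ≡ length xs ^ n
  length-vectors xs zero    = refl
  length-vectors xs (suc n) = trans (length-cartesianProductWith _∷_ xs (vectors xs n))
    (cong (length xs *_) (length-vectors xs n))

  ∈-vectors : ∀ {xs : List A} → (∀ x → x ∈ xs) → ∀ {n} (v : Vec A n) → v ∈ vectors xs n
  ∈-vectors ∈xs []      = here refl
  ∈-vectors ∈xs (x ∷ v) = ∈-cartesianProductWith⁺ _∷_ (∈xs x) (∈-vectors ∈xs v)

  sumOver-cartesianProductWith : ∀ (op : A → B → C) xs ys f →
    sumOver (cartesianProductWith op xs ys) f ≡ sumOver xs (λ x → sumOver ys (λ y → f (op x y)))
  sumOver-cartesianProductWith op []       ys f = refl
  sumOver-cartesianProductWith op (x ∷ xs) ys f = trans (sumOver-++ (map (op x) ys) _ f)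
    (cong₂ _+_ (cong sum (sym (map-∘ ys))) (sumOver-cartesianProductWith op xs ys f))

  bools : List Bool
  bools = true ∷ false ∷ []

  ∈-bools : ∀ b → b ∈ bools
  ∈-bools true  = here refl
  ∈-bools false = there (here refl)

  match : Bool → Bool → ℕ
  match true  true  = 1
  match false false = 1
  match _     _     = 0

  agreement : ∀ {n} → Vec Bool n → (Fin n → Bool) → ℕ
  agreement []       d = 0
  agreement (a ∷ as) d = match a (d zero) + agreement as (d ∘ suc)

  -- The sum factors over coordinates: whatever `d` guesses, the agreeing bit contributes 2 and the
  -- other one 1.
  sum-2^agreement : ∀ n (d : Fin n → Bool) →
    sumOver (vectors bools n) (λ as → 2 ^ agreement as d) ≡ 3 ^ n
  sum-2^agreement zero    d = refl
  sum-2^agreement (suc n) d = begin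
    sumOver (vectors bools (suc n)) (λ as → 2 ^ agreement as d)
      ≡⟨ sumOver-cartesianProductWith _∷_ bools (vectors bools n) _ ⟩
    sumOver bools (λ a → sumOver (vectors bools n) (λ as → 2 ^ (match a (d zero) + agreement as (d ∘ suc))))
      ≡⟨ sumOver-cong bools (λ a → trans
           (sumOver-cong (vectors bools n) λ as → ^-distribˡ-+-* 2 (match a (d zero)) (agreement as (d ∘ suc)))
           (trans (sumOver-* (vectors bools n) (2 ^ match a (d zero)) (λ as → 2 ^ agreement as (d ∘ suc)))
             (cong (2 ^ match a (d zero) *_) (sum-2^agreement n (d ∘ suc))))) ⟩
    sumOver bools (λ a → 2 ^ match a (d zero) * 3 ^ n)
      ≡⟨ both (d zero) ⟩
    3 ^ suc n ∎
    where
    open ≡-Reasoning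
    both : ∀ b → sumOver bools (λ a → 2 ^ match a b * 3 ^ n) ≡ 3 * 3 ^ n
    both true  = solve 1 (λ x → con 2 :* x :+ (con 1 :* x :+ con 0) := con 3 :* x) refl (3 ^ n)
    both false = solve 1 (λ x → con 1 :* x :+ (con 2 :* x :+ con 0) := con 3 :* x) refl (3 ^ n)

  -- Linearity of expectation, multiplied out by the number of coins and by 3.
  agreement-average : ∀ {n} (coins : List C) (as : Vec Bool n) (d : C → Fin n → Bool) c →
    (∀ i → c ≤ 3 * sumOver coins (λ ω → match (lookup as i) (d ω i))) →
    n * c ≤ 3 * sumOver coins (λ ω → agreement as (d ω))
  agreement-average coins []       d c correct = z≤n
  agreement-average coins (a ∷ as) d c correct = ≤-trans
    (+-mono-≤ (correct zero) (agreement-average coins as (λ ω → d ω ∘ suc) c (correct ∘ suc)))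
    (≤-reflexive (trans (sym (*-distribˡ-+ 3 (sumOver coins _) _))
      (cong (3 *_) (sym (sumOver-+ coins _ _)))))

  -- The tangent line of a ↦ 2^a at c, multiplied out; it replaces Jensen's inequality.
  2^-tangent : ∀ c a → 2 ^ c * (1 + a) ≤ 2 ^ a + c * 2 ^ c
  2^-tangent c a with ≤-total c a
  ... | inj₁ c≤a = begin
    2 ^ c * (1 + a)                  ≡⟨ cong (λ a → 2 ^ c * (1 + a)) (m+[n∸m]≡n c≤a) ⟨
    2 ^ c * (1 + (c + d))
      ≡⟨ solve 3 (λ x c d → x :* (con 1 :+ (c :+ d)) := x :* (con 1 :+ d) :+ c :* x) refl (2 ^ c) c d ⟩
    2 ^ c * (1 + d) + c * 2 ^ c      ≤⟨ +-monoˡ-≤ _ (*-monoʳ-≤ (2 ^ c) (n<2^n d)) ⟩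
    2 ^ c * 2 ^ d + c * 2 ^ c        ≡⟨ cong (_+ c * 2 ^ c) (^-distribˡ-+-* 2 c d) ⟨
    2 ^ (c + d) + c * 2 ^ c          ≡⟨ cong (λ a → 2 ^ a + c * 2 ^ c) (m+[n∸m]≡n c≤a) ⟩
    2 ^ a + c * 2 ^ c                ∎
    where
    open ≤-Reasoning
    d = a ∸ c
  ... | inj₂ a≤c with m≤n⇒m<n∨m≡n a≤c
  ...   | inj₁ a<c  = ≤-trans (*-monoʳ-≤ (2 ^ c) a<c) (≤-trans (≤-reflexive (*-comm (2 ^ c) c)) (m≤n+m _ _))
  ...   | inj₂ refl = ≤-reflexive (solve 2 (λ x a → x :* (con 1 :+ a) := x :+ a :* x) refl (2 ^ a) a)

  -- Exponential moments of the number of coordinates guessed correctly: the tangent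
  -- inequality bounds them below, and a union bound over all messages above.
  index-bound : ∀ (coins : List C) → 0 < length coins → ∀ k {s}
    (send : C → Vec Bool (3 * k) → Vec Bool s) (decode : C → Vec Bool s → Fin (3 * k) → Bool) →
    (∀ as i → 2 * length coins ≤ 3 * sumOver coins (λ ω → match (lookup as i) (decode ω (send ω as) i))) →
    32 ^ k ≤ 2 ^ s * 27 ^ k
  index-bound coins 0<∣coins∣ k {s} send decode correct =
    subst (_≤ 2 ^ s * 27 ^ k) 4^k*8^k (subst (4^k * 2 ^ n ≤_) (cong (2 ^ s *_) 3^n≡27^k) bound)
    where
    open ≤-Reasoning
    n = 3 * k
    -- The guaranteed mean agreement, two thirds of `3 * k`. With the tangent taken exactly there,
    -- the term `c * 4^k` cancels in `bound`.
    c = 2 * k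
    ∣C∣ = length coins
    4^k = 2 ^ c
    inputs = vectors bools n
    messages = vectors bools s
    a : Vec Bool n → _ → ℕ
    a as ω = agreement as (decode ω (send ω as))
    ∣inputs∣ : length inputs ≡ 2 ^ n
    ∣inputs∣ = length-vectors bools n
    ∣messages∣ : length messages ≡ 2 ^ s
    ∣messages∣ = length-vectors bools s
    4^k*8^k : 4^k * 2 ^ n ≡ 32 ^ k
    4^k*8^k = trans (sym (^-distribˡ-+-* 2 c n)) (trans (cong (2 ^_) (sym (*-distribʳ-+ k 2 3))) (sym (^-*-assoc 2 5 k)))
    3^n≡27^k : 3 ^ n ≡ 27 ^ k
    3^n≡27^k = sym (^-*-assoc 3 3 k)
    average : ∀ as → c * ∣C∣ ≤ sumOver coins (a as)
    average as = *-cancelˡ-≤ 3 (subst (_≤ 3 * sumOver coins (a as))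
      (solve 2 (λ k C → con 3 :* k :* (con 2 :* C) := con 3 :* (con 2 :* k :* C)) refl k ∣C∣)
      (agreement-average coins as (λ ω → decode ω (send ω as)) (2 * ∣C∣) (correct as)))
    upper : sumOver inputs (λ as → sumOver coins (λ ω → 2 ^ a as ω)) ≤ ∣C∣ * (2 ^ s * 3 ^ n)
    upper = begin
      sumOver inputs (λ as → sumOver coins (λ ω → 2 ^ a as ω))
        ≡⟨ sumOver-swap inputs coins (λ as ω → 2 ^ a as ω) ⟩
      sumOver coins (λ ω → sumOver inputs (λ as → 2 ^ a as ω))
        -- The union bound: once all `2 ^ s` messages are summed, the guess no longer depends on
        -- `as`, and `sum-2^agreement` applies to each message.
        ≤⟨ sumOver-mono coins (λ ω → sumOver-mono inputs (λ as →
             ∈⇒≤sumOver (λ m → 2 ^ agreement as (decode ω m)) (∈-vectors ∈-bools (send ω as)))) ⟩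
      sumOver coins (λ ω → sumOver inputs (λ as → sumOver messages (λ m → 2 ^ agreement as (decode ω m))))
        ≡⟨ sumOver-cong coins (λ ω → trans (sumOver-swap inputs messages _)
             (trans (sumOver-cong messages λ m → sum-2^agreement n (decode ω m))
               (trans (sumOver-const messages (3 ^ n)) (cong (_* 3 ^ n) ∣messages∣)))) ⟩
      sumOver coins (λ ω → 2 ^ s * 3 ^ n)
        ≡⟨ sumOver-const coins _ ⟩
      ∣C∣ * (2 ^ s * 3 ^ n) ∎
    pointwise : ∀ as → 4^k * ((1 + c) * ∣C∣) ≤ sumOver coins (λ ω → 2 ^ a as ω) + ∣C∣ * (c * 4^k)
    pointwise as = begin
      4^k * ((1 + c) * ∣C∣)
        ≤⟨ *-monoʳ-≤ 4^k (+-monoʳ-≤ ∣C∣ (average as)) ⟩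
      4^k * (∣C∣ + sumOver coins (a as))
        ≡⟨ cong (λ z → 4^k * (z + sumOver coins (a as))) (trans (sym (*-identityʳ ∣C∣)) (sym (sumOver-const coins 1))) ⟩
      4^k * (sumOver coins (λ _ → 1) + sumOver coins (a as))
        ≡⟨ cong (4^k *_) (sumOver-+ coins (λ _ → 1) (a as)) ⟨
      4^k * sumOver coins (λ ω → 1 + a as ω)
        ≡⟨ sumOver-* coins 4^k _ ⟨
      sumOver coins (λ ω → 4^k * (1 + a as ω))
        ≤⟨ sumOver-mono coins (λ ω → 2^-tangent c (a as ω)) ⟩
      sumOver coins (λ ω → 2 ^ a as ω + c * 4^k)
        ≡⟨ trans (sumOver-+ coins _ _) (cong (sumOver coins (λ ω → 2 ^ a as ω) +_) (sumOver-const coins _)) ⟩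
      sumOver coins (λ ω → 2 ^ a as ω) + ∣C∣ * (c * 4^k) ∎
    total : 2 ^ n * (4^k * ((1 + c) * ∣C∣)) ≤ ∣C∣ * (2 ^ s * 3 ^ n) + 2 ^ n * (∣C∣ * (c * 4^k))
    total = begin
      2 ^ n * (4^k * ((1 + c) * ∣C∣))
        ≡⟨ trans (cong (_* (4^k * ((1 + c) * ∣C∣))) (sym ∣inputs∣)) (sym (sumOver-const inputs _)) ⟩
      sumOver inputs (λ _ → 4^k * ((1 + c) * ∣C∣))
        ≤⟨ sumOver-mono inputs pointwise ⟩
      sumOver inputs (λ as → sumOver coins (λ ω → 2 ^ a as ω) + ∣C∣ * (c * 4^k))
        ≡⟨ trans (sumOver-+ inputs _ _) (cong (sumOver inputs (λ as → sumOver coins (λ ω → 2 ^ a as ω)) +_)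
             (trans (sumOver-const inputs _) (cong (_* (∣C∣ * (c * 4^k))) ∣inputs∣))) ⟩
      sumOver inputs (λ as → sumOver coins (λ ω → 2 ^ a as ω)) + 2 ^ n * (∣C∣ * (c * 4^k))
        ≤⟨ +-monoˡ-≤ _ upper ⟩
      ∣C∣ * (2 ^ s * 3 ^ n) + 2 ^ n * (∣C∣ * (c * 4^k)) ∎
    bound : 4^k * 2 ^ n ≤ 2 ^ s * 3 ^ n
    bound = *-cancelˡ-≤ ∣C∣ {{>-nonZero 0<∣coins∣}} (+-cancelʳ-≤ (2 ^ n * (∣C∣ * (c * 4^k))) _ _ (≤-trans (≤-reflexive
      (solve 4 (λ C f N c → C :* (f :* N) :+ N :* (C :* (c :* f)) := N :* (f :* ((con 1 :+ c) :* C))) refl ∣C∣ 4^k (2 ^ n) c))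
      total))

open Counting

-- Five is the least exponent at which `32 / 27` gains a factor 2; this is the 5 in the domain size.
2^j*27^[5j]≤32^[5j] : ∀ j → 2 ℕ.^ j ℕ.* 27 ℕ.^ (5 ℕ.* j) ℕ.≤ 32 ℕ.^ (5 ℕ.* j)
2^j*27^[5j]≤32^[5j] j = begin
  2 ℕ.^ j ℕ.* 27 ℕ.^ (5 ℕ.* j)     ≡⟨ cong (2 ℕ.^ j ℕ.*_) (ℕ.^-*-assoc 27 5 j) ⟨
  2 ℕ.^ j ℕ.* (27 ℕ.^ 5) ℕ.^ j     ≡⟨ ^-distribʳ-* j 2 (27 ℕ.^ 5) ⟨
  (2 ℕ.* 27 ℕ.^ 5) ℕ.^ j           ≤⟨ ℕ.^-monoˡ-≤ j (toWitness {a? = 2 ℕ.* 27 ℕ.^ 5 ℕ.≤? 32 ℕ.^ 5} _) ⟩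
  (32 ℕ.^ 5) ℕ.^ j                 ≡⟨ ℕ.^-*-assoc 32 5 j ⟩
  32 ℕ.^ (5 ℕ.* j)                 ∎
  where open ℕ.≤-Reasoning

index-space : ∀ j s → 32 ℕ.^ (5 ℕ.* j) ℕ.≤ 2 ℕ.^ s ℕ.* 27 ℕ.^ (5 ℕ.* j) → j ℕ.≤ s
index-space j s bound = ℕ.≮⇒≥ λ s<j → ℕ.<⇒≱ (ℕ.^-monoʳ-< 2 (s≤s (s≤s z≤n)) s<j)
  (ℕ.*-cancelʳ-≤ (2 ℕ.^ j) (2 ℕ.^ s) (27 ℕ.^ (5 ℕ.* j)) {{ℕ.m^n≢0 27 (5 ℕ.* j)}}
    (ℕ.≤-trans (2^j*27^[5j]≤32^[5j] j) bound))

-- From probabilities and streams to sums over lists.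

-- An event enters the counting through any weight that is at least 1 on it. The witnessing outcomes
-- are distinct, so their number is bounded by the weight of the whole sample space.
Probability≥⇒sumOver : ∀ {K ℓ} a b {E : Pred (Vec (Fin K) ℓ) 0ℓ} (χ : Vec (Fin K) ℓ → ℕ) →
  (∀ {ω} → E ω → 1 ℕ.≤ χ ω) → Probability≥ a b E →
  a ℕ.* length (vectors (allFin K) ℓ) ℕ.≤ b ℕ.* sumOver (vectors (allFin K) ℓ) χ
Probability≥⇒sumOver {K} {ℓ} a b χ E⇒χ (outcomes , unique , allE , large) = begin
  a ℕ.* length (vectors (allFin K) ℓ)      ≡⟨ cong (a ℕ.*_) (≡.trans (length-vectors (allFin K) ℓ)
                                              (cong (ℕ._^ ℓ) (length-tabulate {n = K} (λ i → i)))) ⟩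
  a ℕ.* K ℕ.^ ℓ                            ≤⟨ large ⟩
  b ℕ.* length outcomes                    ≤⟨ ℕ.*-monoʳ-≤ b (count allE) ⟩
  b ℕ.* sumOver outcomes χ                 ≤⟨ ℕ.*-monoʳ-≤ b (sumOver-⊆ χ unique (λ _ → ∈-vectors ∈-allFin _)) ⟩
  b ℕ.* sumOver (vectors (allFin K) ℓ) χ   ∎
  where
  open ℕ.≤-Reasoning
  count : ∀ {ωs} → All _ ωs → length ωs ℕ.≤ sumOver ωs χ
  count []       = z≤n
  count (e ∷ es) = ℕ.+-mono-≤ (E⇒χ e) (count es)

insert : ∀ {n} → Fin n × ℕ → Update n
insert (i , w) = i , ℤ.+ w

weightAt : ∀ {n} → Fin n → Fin n × ℕ → ℕ
weightAt i (j , w) = if does (j Fin.≟ i) then w else 0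

frequency-inserts : ∀ {n} (l : List (Fin n × ℕ)) i →
  frequency (map insert l) i ≡ ℤ.+ sumOver l (weightAt i)
frequency-inserts []            i = ≡.refl
frequency-inserts ((j , w) ∷ l) i with does (j Fin.≟ i)
... | true  = cong (λ z → (ℤ.+ w) ℤ.+ z) (frequency-inserts l i)
... | false = cong (λ z → ℤ.0ℤ ℤ.+ z) (frequency-inserts l i)

sumOver-take : ∀ {A : Set} k (xs : List A) f → sumOver (take k xs) f ℕ.≤ sumOver xs f
sumOver-take zero    xs       f = z≤n
sumOver-take (suc k) []       f = z≤n
sumOver-take (suc k) (x ∷ xs) f = ℕ.+-monoʳ-≤ (f x) (sumOver-take k xs f)

sumOver-select : ∀ {n} {is : List (Fin n)} {i} (w : Fin n → ℕ) → Unique is → i ∈ is →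
  sumOver is (λ j → weightAt i (j , w j)) ≡ w i
sumOver-select {is = i ∷ is} w (i∉is ∷ _) (here ≡.refl) rewrite dec-true (i Fin.≟ i) ≡.refl =
  ≡.trans (cong (w i ℕ.+_) (vanish i∉is)) (ℕ.+-identityʳ _)
  where
  vanish : ∀ {js} → All (i ≢_) js → sumOver js (λ j → weightAt i (j , w j)) ≡ 0
  vanish []                    = ≡.refl
  vanish {j ∷ _} (i≢j ∷ i∉js) rewrite dec-false (j Fin.≟ i) (i≢j ∘ ≡.sym) = vanish i∉js
sumOver-select {is = j ∷ is} {i} w (j∉is ∷ is!) (there i∈is)
  rewrite dec-false (j Fin.≟ i) (All.lookup j∉is i∈is) = sumOver-select w is! i∈is

-- The parameters of the reduction: y has about b i bits, where y^α ≥ 2^(2i), and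
-- the domain has size n = 15 * 2^i; e bounds the number of bits of n M for M = 2 y.
module Parameters (b c E : ℕ) where

  open +-*-Solver using (solve; con; _:+_; _:*_; _:=_)

  e : ℕ → ℕ
  e i = 5 ℕ.+ i ℕ.+ b ℕ.* suc i

  -- The constants met in `domain-bound`: 15 from the domain, `suc b ^ E` from the weight of the
  -- logarithm at `y`, `4 * (4 * c)` from the accuracy, and `6 + b` from
  -- `suc (e i) ≤ (6 + b) * suc i`.
  C : ℕ
  C = 15 ℕ.* suc b ℕ.^ E ℕ.* (4 ℕ.* (4 ℕ.* c)) ℕ.* (6 ℕ.+ b)

  domain : ℕ → ℕ
  domain i = 3 ℕ.* (5 ℕ.* 2 ℕ.^ i)

  -- Here `k` and `l` are the bit lengths of `y` and `n * M`, both linear in `i`. Of the two factors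
  -- `2 ^ i` on the right, one is the domain and the other absorbs the polynomial in `i`.
  domain-bound : ∀ {i k l} → C ℕ.* suc i ℕ.^ suc E ℕ.≤ 2 ℕ.^ i → k ℕ.≤ b ℕ.* suc i → l ℕ.≤ e i →
    domain i ℕ.* suc k ℕ.^ E ℕ.* (4 ℕ.* (4 ℕ.* c) ℕ.* suc l) ℕ.≤ 2 ℕ.^ (i ℕ.+ i)
  domain-bound {i} {k} {l} C≤ k≤ l≤ = begin
    domain i ℕ.* suc k ℕ.^ E ℕ.* (d ℕ.* suc l)
      ≤⟨ ℕ.*-mono-≤ (ℕ.*-monoʳ-≤ (domain i) (ℕ.^-monoˡ-≤ E (ℕ.+-mono-≤ (s≤s (z≤n {i})) k≤)))
                    (ℕ.*-monoʳ-≤ d (ℕ.≤-trans (s≤s l≤) (ℕ.≤-trans (ℕ.m≤m+n _ (5 ℕ.* i)) (ℕ.≤-reflexive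
                      (solve 2 (λ i b → con 1 :+ (con 5 :+ i :+ b :* (con 1 :+ i)) :+ con 5 :* i := (con 6 :+ b) :* (con 1 :+ i)) ≡.refl i b))))) ⟩
    domain i ℕ.* (suc b ℕ.* suc i) ℕ.^ E ℕ.* (d ℕ.* ((6 ℕ.+ b) ℕ.* suc i))
      ≡⟨ ≡.cong (λ z → domain i ℕ.* z ℕ.* (d ℕ.* ((6 ℕ.+ b) ℕ.* suc i))) (^-distribʳ-* E (suc b) (suc i)) ⟩
    domain i ℕ.* (suc b ℕ.^ E ℕ.* suc i ℕ.^ E) ℕ.* (d ℕ.* ((6 ℕ.+ b) ℕ.* suc i))
      ≡⟨ solve 6 (λ p be ie d b i → con 3 :* (con 5 :* p) :* (be :* ie) :* (d :* ((con 6 :+ b) :* i)) :=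
                   p :* (con 15 :* be :* d :* (con 6 :+ b) :* (i :* ie))) ≡.refl (2 ℕ.^ i) (suc b ℕ.^ E) (suc i ℕ.^ E) d b (suc i) ⟩
    2 ℕ.^ i ℕ.* (C ℕ.* suc i ℕ.^ suc E)
      ≤⟨ ℕ.*-monoʳ-≤ (2 ℕ.^ i) C≤ ⟩
    2 ℕ.^ i ℕ.* 2 ℕ.^ i
      ≡⟨ ℕ.^-distribˡ-+-* 2 i i ⟨
    2 ℕ.^ (i ℕ.+ i) ∎
    where
    open ℕ.≤-Reasoning
    d = 4 ℕ.* (4 ℕ.* c)

  domain*2y< : ∀ {i y} → y ℕ.< 2 ℕ.^ (b ℕ.* suc i) → domain i ℕ.* (2 ℕ.* y) ℕ.< 2 ℕ.^ e i
  domain*2y< {i} {y} y< = begin-strict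
    domain i ℕ.* (2 ℕ.* y)
      ≡⟨ solve 2 (λ p y → con 3 :* (con 5 :* p) :* (con 2 :* y) := p :* (con 30 :* y)) ≡.refl (2 ℕ.^ i) y ⟩
    2 ℕ.^ i ℕ.* (30 ℕ.* y)                            ≤⟨ ℕ.*-monoʳ-≤ (2 ℕ.^ i) (ℕ.*-monoˡ-≤ y (ℕ.m≤m+n 30 2)) ⟩
    2 ℕ.^ i ℕ.* (32 ℕ.* y)                            <⟨ ℕ.*-monoʳ-< (2 ℕ.^ i) {{ℕ.m^n≢0 2 i}} (ℕ.*-monoʳ-< 32 y<) ⟩
    2 ℕ.^ i ℕ.* (2 ℕ.^ 5 ℕ.* 2 ℕ.^ (b ℕ.* suc i))
      ≡⟨ solve 3 (λ p q r → p :* (q :* r) := q :* p :* r) ≡.refl (2 ℕ.^ i) (2 ℕ.^ 5) (2 ℕ.^ (b ℕ.* suc i)) ⟩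
    2 ℕ.^ 5 ℕ.* 2 ℕ.^ i ℕ.* 2 ℕ.^ (b ℕ.* suc i)       ≡⟨ ≡.cong (ℕ._* 2 ℕ.^ (b ℕ.* suc i)) (ℕ.^-distribˡ-+-* 2 5 i) ⟨
    2 ℕ.^ (5 ℕ.+ i) ℕ.* 2 ℕ.^ (b ℕ.* suc i)           ≡⟨ ℕ.^-distribˡ-+-* 2 (5 ℕ.+ i) (b ℕ.* suc i) ⟨
    2 ℕ.^ e i                                         ∎
    where
    open ℕ.≤-Reasoning

  -- A bound without constant term makes `n * M` smaller than a fixed power of `2 ^ i`.
  e≤ : ∀ {i} → 1 ℕ.≤ i → e i ℕ.≤ i ℕ.* suc (5 ℕ.+ (b ℕ.+ b))
  e≤ {i} 1≤i = begin
    5 ℕ.+ i ℕ.+ b ℕ.* suc i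
      ≡⟨ solve 2 (λ i b → con 5 :+ i :+ b :* (con 1 :+ i) := (con 5 :+ b) :* con 1 :+ (i :+ b :* i)) ≡.refl i b ⟩
    (5 ℕ.+ b) ℕ.* 1 ℕ.+ (i ℕ.+ b ℕ.* i)                    ≤⟨ ℕ.+-monoˡ-≤ _ (ℕ.*-monoʳ-≤ (5 ℕ.+ b) 1≤i) ⟩
    (5 ℕ.+ b) ℕ.* i ℕ.+ (i ℕ.+ b ℕ.* i)
      ≡⟨ solve 2 (λ i b → (con 5 :+ b) :* i :+ (i :+ b :* i) := i :* (con 1 :+ (con 5 :+ (b :+ b)))) ≡.refl i b ⟩
    i ℕ.* suc (5 ℕ.+ (b ℕ.+ b))                            ∎
    where
    open ℕ.≤-Reasoning

  1≤domain : ∀ i → 1 ℕ.≤ domain i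
  1≤domain i = ℕ.*-mono-≤ {1} {3} (s≤s z≤n) (ℕ.*-mono-≤ {1} {5} (s≤s z≤n) (ℕ.m^n>0 2 i))

  y≤domain*2y : ∀ i y → y ℕ.≤ domain i ℕ.* (2 ℕ.* y)
  y≤domain*2y i y = ℕ.≤-trans (ℕ.m≤m+n y (y ℕ.+ 0)) (ℕ.m≤n*m (2 ℕ.* y) (domain i) {{ℕ.>-nonZero (1≤domain i)}})

module Proof (R : CompleteOrderedField) where

  open Streaming R hiding (zero; _-_)

  -- Ordered-field arithmetic and real powers as suprema.

  module OrderedField where
    open Algebra.Solver.Ring.NaturalCoefficients.Default
      commutativeSemiring public
      using (solve; con; _:+_; _:*_; _:=_; Polynomial)
    open Algebra.Properties.CommutativeSemiring.Exp
      commutativeSemiring public using (^-distrib-*)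
    open Algebra.Properties.Semiring.Exp semiring public using (^-homo-*; ^-assocʳ; ^-congˡ)
    open Algebra.Properties.Semiring.Mult semiring public using (×-homo-+; ×1-homo-*)

    -- Evaluates to `1# + (... + 0#)`, the unfolding of `fromℕ k`, so that solver equations apply to
    -- terms such as `fromℕ 4` as they stand.
    numeral : ∀ {n} → ℕ → Polynomial n
    numeral zero    = con 0
    numeral (suc k) = con 1 :+ numeral k

    module ≤-Reasoning = Relation.Binary.Reasoning.Base.Triple
      (StrictToNonStrict.isPreorder₂ _≈_ _<_ (IsStrictTotalOrder.isStrictPartialOrder isStrictTotalOrder))
      asym <-trans <-resp-≈ inj₁ <-≤-trans ≤-<-trans
    open ≤-Reasoning
    open import Algebra.Properties.Ring ring using (-‿involutive; -0#≈0#)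

    ≤-antisym : ∀ {x y} → x ≤ y → y ≤ x → x ≈ y
    ≤-antisym (inj₂ x≈y) _          = x≈y
    ≤-antisym _          (inj₂ y≈x) = sym y≈x
    ≤-antisym (inj₁ x<y) (inj₁ y<x) = contradiction y<x (asym x<y)

    0<⇒≉0 : ∀ {x} → 0# < x → ¬ x ≈ 0#
    0<⇒≉0 0<x x≈0 = irrefl (sym x≈0) 0<x

    +-mono-≤ : ∀ {a b c d} → a ≤ b → c ≤ d → a + c ≤ b + d
    +-mono-≤ {a} {b} {c} {d} a≤b c≤d = begin
      a + c  ≈⟨ +-comm a c ⟩
      c + a  ≤⟨ +-monoʳ-≤ c a≤b ⟩
      c + b  ≈⟨ +-comm c b ⟩
      b + c  ≤⟨ +-monoʳ-≤ b c≤d ⟩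
      b + d  ∎

    +-cancelʳ : ∀ x z → x + z + - z ≈ x
    +-cancelʳ x z = trans (+-assoc x z (- z)) (trans (+-congˡ (-‿inverseʳ z)) (+-identityʳ x))

    +-cancelʳ-≤ : ∀ z {x y} → x + z ≤ y + z → x ≤ y
    +-cancelʳ-≤ z {x} {y} x+z≤y+z = begin
      x            ≈⟨ +-cancelʳ x z ⟨
      x + z + - z  ≤⟨ +-mono-≤ x+z≤y+z ≤-refl ⟩
      y + z + - z  ≈⟨ +-cancelʳ y z ⟩
      y            ∎

    +-cancelʳ-< : ∀ z {x y} → x + z < y + z → x < y
    +-cancelʳ-< z {x} {y} x+z<y+z = begin-strict
      x            ≈⟨ +-cancelʳ x z ⟨
      x + z + - z  <⟨ +-monoˡ-< (- z) x+z<y+z ⟩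
      y + z + - z  ≈⟨ +-cancelʳ y z ⟩
      y            ∎

    ≤-+ʳ : ∀ {x y} → 0# ≤ y → x ≤ x + y
    ≤-+ʳ {x} {y} 0≤y = begin
      x       ≈⟨ +-identityʳ x ⟨
      x + 0#  ≤⟨ +-monoʳ-≤ x 0≤y ⟩
      x + y   ∎

    ≤-+ˡ : ∀ {x y} → 0# ≤ y → x ≤ y + x
    ≤-+ˡ {x} {y} 0≤y = begin
      x      ≤⟨ ≤-+ʳ 0≤y ⟩
      x + y  ≈⟨ +-comm x y ⟩
      y + x  ∎

    0≤+ : ∀ {x y} → 0# ≤ x → 0# ≤ y → 0# ≤ x + y
    0≤+ 0≤x 0≤y = ≤-trans 0≤x (≤-+ʳ 0≤y)

    *-mono-≤ : ∀ {a b c d} → 0# ≤ b → 0# ≤ c → a ≤ b → c ≤ d → a * c ≤ b * d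
    *-mono-≤ 0≤b 0≤c a≤b c≤d = ≤-trans (*-monoˡ-≤ 0≤c a≤b) (*-monoʳ-≤ 0≤b c≤d)

    0≤* : ∀ {x y} → 0# ≤ x → 0# ≤ y → 0# ≤ x * y
    0≤* {x} {y} 0≤x 0≤y = begin
      0#      ≈⟨ zeroʳ x ⟨
      x * 0#  ≤⟨ *-monoʳ-≤ 0≤x 0≤y ⟩
      x * y   ∎

    x≤x*y : ∀ {x y} → 0# ≤ x → 1# ≤ y → x ≤ x * y
    x≤x*y {x} {y} 0≤x 1≤y = begin
      x       ≈⟨ *-identityʳ x ⟨
      x * 1#  ≤⟨ *-monoʳ-≤ 0≤x 1≤y ⟩
      x * y   ∎

    *-cancelʳ-≤ : ∀ {z x y} → 0# < z → x * z ≤ y * z → x ≤ y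
    *-cancelʳ-≤ 0<z xz≤yz = ≮⇒≥ λ y<x → ≤⇒≯ xz≤yz (*-monoˡ-< 0<z y<x)

    *-cancelʳ-< : ∀ {z x y} → 0# ≤ z → x * z < y * z → x < y
    *-cancelʳ-< {z} {x} {y} 0≤z xz<yz with compare x y
    ... | tri< x<y _ _ = x<y
    ... | tri≈ _ x≈y _ = contradiction xz<yz (irrefl (*-congʳ x≈y))
    ... | tri> _ _ y<x = contradiction xz<yz (≤⇒≯ (*-monoˡ-≤ 0≤z (inj₁ y<x)))

    ⁻¹-inverseˡ : ∀ {x} → 0# < x → x ⁻¹ * x ≈ 1#
    ⁻¹-inverseˡ 0<x = trans (*-comm _ _) (⁻¹-inverseʳ (0<⇒≉0 0<x))

    *-⁻¹-cancelʳ : ∀ {x z} → 0# < z → x * z ⁻¹ * z ≈ x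
    *-⁻¹-cancelʳ {x} 0<z = trans (*-assoc x _ _) (trans (*-congˡ (⁻¹-inverseˡ 0<z)) (*-identityʳ x))

    0<⁻¹ : ∀ {x} → 0# < x → 0# < x ⁻¹
    0<⁻¹ {x} 0<x = *-cancelʳ-< (inj₁ 0<x) (begin-strict
      0# * x    ≈⟨ zeroˡ x ⟩
      0#        <⟨ 0<1 ⟩
      1#        ≈⟨ ⁻¹-inverseˡ 0<x ⟨
      x ⁻¹ * x  ∎)

    *≤⇒≤/ : ∀ {x y z} → 0# < z → x * z ≤ y → x ≤ y * z ⁻¹
    *≤⇒≤/ {x} {y} {z} 0<z xz≤y = *-cancelʳ-≤ 0<z (begin
      x * z         ≤⟨ xz≤y ⟩
      y             ≈⟨ *-⁻¹-cancelʳ 0<z ⟨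
      y * z ⁻¹ * z  ∎)

    ≤/⇒*≤ : ∀ {x y z} → 0# < z → x ≤ y * z ⁻¹ → x * z ≤ y
    ≤/⇒*≤ {x} {y} {z} 0<z x≤y/z = begin
      x * z         ≤⟨ *-monoˡ-≤ (inj₁ 0<z) x≤y/z ⟩
      y * z ⁻¹ * z  ≈⟨ *-⁻¹-cancelʳ 0<z ⟩
      y             ∎

    ⁻¹-antitone : ∀ {x y} → 0# < x → x ≤ y → y ⁻¹ ≤ x ⁻¹
    ⁻¹-antitone {x} {y} 0<x x≤y = begin
      y ⁻¹            ≈⟨ *-identityˡ _ ⟨
      1# * y ⁻¹       ≈⟨ *-congʳ (⁻¹-inverseˡ 0<x) ⟨
      x ⁻¹ * x * y ⁻¹ ≤⟨ *-monoˡ-≤ (inj₁ (0<⁻¹ 0<y)) (*-monoʳ-≤ (inj₁ (0<⁻¹ 0<x)) x≤y) ⟩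
      x ⁻¹ * y * y ⁻¹ ≈⟨ *-assoc _ _ _ ⟩
      x ⁻¹ * (y * y ⁻¹) ≈⟨ *-congˡ (⁻¹-inverseʳ (0<⇒≉0 0<y)) ⟩
      x ⁻¹ * 1#       ≈⟨ *-identityʳ _ ⟩
      x ⁻¹            ∎
      where 0<y = <-≤-trans 0<x x≤y

    ⁻¹-unique : ∀ {x y} → 0# < y → x * y ≈ 1# → x ≈ y ⁻¹
    ⁻¹-unique {x} {y} 0<y xy≈1 = ≤-antisym
      (≤-trans (*≤⇒≤/ 0<y (inj₂ xy≈1)) (inj₂ (*-identityˡ _)))
      (*-cancelʳ-≤ 0<y (inj₂ (trans (⁻¹-inverseˡ 0<y) (sym xy≈1))))

    ≤∣∣ : ∀ x → x ≤ ∣ x ∣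
    ≤∣∣ x with compare x 0#
    ... | tri< x<0 _ _ = inj₁ (<-trans x<0 (-‿pos x<0))
    ... | tri≈ _ _ _   = ≤-refl
    ... | tri> _ _ _   = ≤-refl

    -≤∣∣ : ∀ x → 0# ≤ x + ∣ x ∣
    -≤∣∣ x with compare x 0#
    ... | tri< x<0 _ _ = inj₂ (sym (-‿inverseʳ x))
    ... | tri≈ _ x≈0 _ = inj₂ (sym (trans (+-cong x≈0 x≈0) (+-identityʳ 0#)))
    ... | tri> _ _ 0<x = 0≤+ (inj₁ 0<x) (inj₁ 0<x)

    0≤⇒∣∣≈ : ∀ {x} → 0# ≤ x → ∣ x ∣ ≈ x
    0≤⇒∣∣≈ {x} 0≤x with compare x 0#
    ... | tri< x<0 _ _ = contradiction x<0 (≤⇒≯ 0≤x)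
    ... | tri≈ _ _ _   = refl
    ... | tri> _ _ _   = refl

    ⊓≤ˡ : ∀ x y → x ⊓ y ≤ x
    ⊓≤ˡ x y with compare x y
    ... | tri< _ _ _   = ≤-refl
    ... | tri≈ _ _ _   = ≤-refl
    ... | tri> _ _ y<x = inj₁ y<x

    fromℕ-mono-≤ : ∀ {m n} → m ℕ.≤ n → fromℕ m ≤ fromℕ n
    fromℕ-mono-≤ m≤n with ℕ.m≤n⇒m<n∨m≡n m≤n
    ... | inj₁ m<n    = inj₁ (fromℕ-mono-< m<n)
    ... | inj₂ ≡.refl = ≤-refl

    fromℕ-cancel-< : ∀ {m n} → fromℕ m < fromℕ n → m ℕ.< n
    fromℕ-cancel-< m<n = ℕ.≰⇒> λ n≤m → ≤⇒≯ (fromℕ-mono-≤ n≤m) m<n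

    fromℕ-1 : fromℕ 1 ≈ 1#
    fromℕ-1 = +-identityʳ 1#

    fromℕ-+ : ∀ m n → fromℕ (m ℕ.+ n) ≈ fromℕ m + fromℕ n
    fromℕ-+ m n = ×-homo-+ 1# m n

    fromℕ-* : ∀ m n → fromℕ (m ℕ.* n) ≈ fromℕ m * fromℕ n
    fromℕ-* = ×1-homo-*

    fromℕ-^ : ∀ m k → fromℕ (m ℕ.^ k) ≈ fromℕ m ^ℕ k
    fromℕ-^ m zero    = fromℕ-1
    fromℕ-^ m (suc k) = trans (fromℕ-* m (m ℕ.^ k)) (*-congˡ (fromℕ-^ m k))

    0<fromℕ : ∀ {n} → 0 ℕ.< n → 0# < fromℕ n
    0<fromℕ = fromℕ-mono-<

    1≤fromℕ : ∀ {n} → 1 ℕ.≤ n → 1# ≤ fromℕ n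
    1≤fromℕ {suc n} _ = 1≤fromℕ[1+n] n

    0≤^ℕ : ∀ {a} n → 0# ≤ a → 0# ≤ a ^ℕ n
    0≤^ℕ zero    0≤a = inj₁ 0<1
    0≤^ℕ (suc n) 0≤a = 0≤* 0≤a (0≤^ℕ n 0≤a)

    ^ℕ-monoˡ-≤ : ∀ {a b} n → 0# ≤ a → a ≤ b → a ^ℕ n ≤ b ^ℕ n
    ^ℕ-monoˡ-≤ zero    0≤a a≤b = ≤-refl
    ^ℕ-monoˡ-≤ (suc n) 0≤a a≤b = *-mono-≤ (≤-trans 0≤a a≤b) (0≤^ℕ n 0≤a) a≤b (^ℕ-monoˡ-≤ n 0≤a a≤b)

    ^ℕ-cancel-≤ : ∀ {a b} n → 0# ≤ b → a ^ℕ suc n ≤ b ^ℕ suc n → a ≤ b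
    ^ℕ-cancel-≤ n (inj₁ 0<b) a^n≤b^n = ≮⇒≥ λ b<a → ≤⇒≯ a^n≤b^n (^ℕ-monoˡ-< n 0<b b<a)
    ^ℕ-cancel-≤ n (inj₂ 0≈b) a^n≤b^n = ≮⇒≥ λ b<a → ≤⇒≯
      (≤-trans a^n≤b^n (inj₂ (trans (*-congʳ (sym 0≈b)) (zeroˡ _))))
      (0<^ℕ (suc n) (<-respˡ-≈ (sym 0≈b) b<a))

    supremum-unique : ∀ {P Q : Pred ℝ 0ℓ} {s t} → (∀ y → P y → Q y) → (∀ y → Q y → P y) →
      IsSupremum P s → IsSupremum Q t → s ≈ t
    supremum-unique P⊆Q Q⊆P (s-ub , s-least) (t-ub , t-least) = ≤-antisym
      (≮⇒≥ λ t<s → let y , Py , t<y = s-least _ t<s in ≤⇒≯ (t-ub y (P⊆Q y Py)) t<y)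
      (≮⇒≥ λ s<t → let y , Qy , s<y = t-least _ s<t in ≤⇒≯ (s-ub y (Q⊆P y Qy)) s<y)

    supremum-≤ : ∀ {P : Pred ℝ 0ℓ} {s c} → IsSupremum P s → (∀ y → P y → y ≤ c) → s ≤ c
    supremum-≤ (_ , s-least) P≤c = ≮⇒≥ λ c<s → let y , Py , c<y = s-least _ c<s in ≤⇒≯ (P≤c y Py) c<y

    reciprocal-bound : ∀ {α} → 0# < α → ∃[ q ] 1# ≤ fromℕ (suc q) * α
    reciprocal-bound {α} 0<α with archimedean (α ⁻¹)
    ... | q , α⁻¹≤q = q , (begin
      1#                 ≈⟨ ⁻¹-inverseˡ 0<α ⟨
      α ⁻¹ * α           ≤⟨ *-monoˡ-≤ (inj₁ 0<α) (≤-trans α⁻¹≤q (≤-+ˡ (inj₁ 0<1))) ⟩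
      fromℕ (suc q) * α  ∎)

    ⁻¹-cong : ∀ {x y} → 0# < x → x ≈ y → x ⁻¹ ≈ y ⁻¹
    ⁻¹-cong 0<x x≈y = ⁻¹-unique (<-respʳ-≈ x≈y 0<x) (trans (*-congˡ (sym x≈y)) (⁻¹-inverseˡ 0<x))

    -- The proof of `1# ≤ a` used inside `powBy` depends on the outcome of `compare`, hence the
    -- existential over it.
    ^≡pow≥1± : ∀ {a} α → 1# ≤ a → ∃[ p ] a ^ α ≡ pow≥1± {a} {α} p (compare α 0#)
    ^≡pow≥1± {a} α 1≤a with compare a 0#
    ... | tri< a<0 _ _ = contradiction (<-≤-trans 0<1 1≤a) (asym a<0)
    ... | tri≈ _ a≈0 _ = contradiction a≈0 (0<⇒≉0 (<-≤-trans 0<1 1≤a))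
    ... | tri> _ _ 0<a with compare a 1#
    ...   | tri< a<1 _ _ = contradiction a<1 (≤⇒≯ 1≤a)
    ...   | tri≈ _ a≈1 _ = inj₂ (sym a≈1) , ≡.refl
    ...   | tri> _ _ 1<a = inj₁ 1<a , ≡.refl

    module _ {a α} (1≤a : 1# ≤ a) (0<α : 0# < α) where

      ^-isSupremum : IsSupremum (RationalPowers a α) (a ^ α)
      ^-isSupremum with ^≡pow≥1± α 1≤a
      ... | p , eq rewrite eq with compare α 0#
      ...   | tri< α<0 _ _ = contradiction 0<α (asym α<0)
      ...   | tri≈ _ α≈0 _ = contradiction α≈0 (0<⇒≉0 0<α)
      ...   | tri> _ _ 0<α = proj₂ (pow≥1-sup p (inj₁ 0<α))

      ≤-^ : ∀ {z} → RationalPowers a α z → z ≤ a ^ α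
      ≤-^ = proj₁ ^-isSupremum _

      ^-≤ : ∀ {c} → (∀ z → RationalPowers a α z → z ≤ c) → a ^ α ≤ c
      ^-≤ = supremum-≤ ^-isSupremum

      1≤^ : 1# ≤ a ^ α
      1≤^ = ≤-^ (one∈RationalPowers a (inj₁ 0<α))

      0<^ : 0# < a ^ α
      0<^ = <-≤-trans 0<1 1≤^

      ^-neg : a ^ (- α) ≈ (a ^ α) ⁻¹
      ^-neg with ^≡pow≥1± (- α) 1≤a
      ... | p , eq rewrite eq with compare (- α) 0#
      ...   | tri≈ _ -α≈0 _ = contradiction (trans (sym (-‿involutive α)) (trans (-‿cong -α≈0) -0#≈0#)) (0<⇒≉0 0<α)
      ...   | tri> _ _ 0<-α = contradiction (neg-pos⇒neg 0<-α) (asym 0<α)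
        where
        neg-pos⇒neg : 0# < - α → α < 0#
        neg-pos⇒neg 0<-α = <-respˡ-≈ (+-identityˡ α) (<-respʳ-≈ (-‿inverseˡ α) (+-monoˡ-< α 0<-α))
      -- The power is now taken at `- (- α)`, which is only `≈` to `α`; the two sets of rational
      -- powers coincide, hence so do their suprema.
      ...   | tri< -α<0 _ _ = sym (⁻¹-cong 0<^ (supremum-unique
          (λ { y (0≤y , m , n , m≤nα , y^n≤a^m) → 0≤y , m , n , ≤-trans m≤nα (inj₂ (*-congˡ (sym (-‿involutive α)))) , y^n≤a^m })
          (λ { y (0≤y , m , n , m≤nα , y^n≤a^m) → 0≤y , m , n , ≤-trans m≤nα (inj₂ (*-congˡ (-‿involutive α))) , y^n≤a^m })
          ^-isSupremum (proj₂ (pow≥1-sup p (inj₁ (-‿pos -α<0))))))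

      0<^-neg : 0# < a ^ (- α)
      0<^-neg = <-respʳ-≈ (sym ^-neg) (0<⁻¹ 0<^)

      -- The exponent `1 / suc q` is at most `α`, so `z` itself belongs to the set whose supremum is
      -- `a ^ α`.
      root≤^ : ∀ {z} q → 0# ≤ z → 1# ≤ fromℕ (suc q) * α → z ^ℕ suc q ≤ a → z ≤ a ^ α
      root≤^ q 0≤z 1≤qα z^q≤a = ≤-^ (0≤z , 1 , q , ≤-trans (inj₂ fromℕ-1) 1≤qα ,
        ≤-trans z^q≤a (inj₂ (sym (*-identityʳ a))))

    -- An upper bound on the supremum is checked on each rational power; raised to its denominator,
    -- it becomes a comparison of integer exponents.
    ^-≤-^ℕ : ∀ {a b α} E → 1# ≤ a → 0# < α → a ≤ b → α ≤ fromℕ E → a ^ α ≤ b ^ℕ E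
    ^-≤-^ℕ {a} {b} {α} E 1≤a 0<α a≤b α≤E = ^-≤ 1≤a 0<α λ { z (0≤z , m , n , m≤nα , z^n≤a^m) →
      ^ℕ-cancel-≤ n (0≤^ℕ E (≤-trans (inj₁ 0<1) 1≤b)) (begin
        z ^ℕ suc n          ≤⟨ z^n≤a^m ⟩
        a ^ℕ m              ≤⟨ ^ℕ-monoˡ-≤ m (≤-trans (inj₁ 0<1) 1≤a) a≤b ⟩
        b ^ℕ m              ≤⟨ ^ℕ-monoʳ-≤ 1≤b (m≤En m n m≤nα) ⟩
        b ^ℕ (E ℕ.* suc n)  ≈⟨ ^-assocʳ b E (suc n) ⟨
        (b ^ℕ E) ^ℕ suc n   ∎) }
      where
      1≤b = ≤-trans 1≤a a≤b
      m≤En : ∀ m n → fromℕ m ≤ fromℕ (suc n) * α → m ℕ.≤ E ℕ.* suc n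
      m≤En m n m≤nα = fromℕ-cancel-≤ (begin
        fromℕ m                  ≤⟨ m≤nα ⟩
        fromℕ (suc n) * α        ≤⟨ *-monoʳ-≤ (0≤fromℕ (suc n)) α≤E ⟩
        fromℕ (suc n) * fromℕ E  ≈⟨ *-comm _ _ ⟩
        fromℕ E * fromℕ (suc n)  ≈⟨ fromℕ-* E (suc n) ⟨
        fromℕ (E ℕ.* suc n)      ∎)

    ^-≤-root : ∀ {a c β} B → 1# ≤ a → 1# ≤ c → 0# < β → fromℕ (suc B) * β ≤ 1# → a ≤ c ^ℕ suc B → a ^ β ≤ c
    ^-≤-root {a} {c} {β} B 1≤a 1≤c 0<β Bβ≤1 a≤c^B = ^-≤ 1≤a 0<β λ { z (0≤z , m , n , m≤nβ , z^n≤a^m) →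
      ^ℕ-cancel-≤ n (≤-trans (inj₁ 0<1) 1≤c) (begin
        z ^ℕ suc n           ≤⟨ z^n≤a^m ⟩
        a ^ℕ m               ≤⟨ ^ℕ-monoˡ-≤ m (≤-trans (inj₁ 0<1) 1≤a) a≤c^B ⟩
        (c ^ℕ suc B) ^ℕ m    ≈⟨ ^-assocʳ c (suc B) m ⟩
        c ^ℕ (suc B ℕ.* m)   ≤⟨ ^ℕ-monoʳ-≤ 1≤c (Bm≤n m n m≤nβ) ⟩
        c ^ℕ suc n           ∎) }
      where
      Bm≤n : ∀ m n → fromℕ m ≤ fromℕ (suc n) * β → suc B ℕ.* m ℕ.≤ suc n
      Bm≤n m n m≤nβ = fromℕ-cancel-≤ (begin
        fromℕ (suc B ℕ.* m)                  ≈⟨ fromℕ-* (suc B) m ⟩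
        fromℕ (suc B) * fromℕ m              ≤⟨ *-monoʳ-≤ (0≤fromℕ (suc B)) m≤nβ ⟩
        fromℕ (suc B) * (fromℕ (suc n) * β)
          ≈⟨ solve 3 (λ B n β → B :* (n :* β) := n :* (B :* β)) refl (fromℕ (suc B)) (fromℕ (suc n)) β ⟩
        fromℕ (suc n) * (fromℕ (suc B) * β)  ≤⟨ *-monoʳ-≤ (0≤fromℕ (suc n)) Bβ≤1 ⟩
        fromℕ (suc n) * 1#                   ≈⟨ *-identityʳ _ ⟩
        fromℕ (suc n)                        ∎)

    -- As w^Q ≥ 1, it may be raised to any power p with p Q ≥ 1.
    scaled-^ : ∀ {a b w α} Q → 1# ≤ a → 1# ≤ w → 0# < α → 1# ≤ fromℕ (suc Q) * α →
      w ^ℕ suc Q * a ≤ b → w * a ^ α ≤ b ^ α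
    scaled-^ {a} {b} {w} {α} Q 1≤a 1≤w 0<α 1≤Qα w^Qa≤b = begin
      w * a ^ α           ≈⟨ *-comm _ _ ⟩
      a ^ α * w           ≤⟨ ≤/⇒*≤ 0<w (^-≤ 1≤a 0<α λ z z∈ → *≤⇒≤/ 0<w (scale z z∈)) ⟩
      b ^ α               ∎
      where
      0<w = <-≤-trans 0<1 1≤w
      0≤a = ≤-trans (inj₁ 0<1) 1≤a
      W = w ^ℕ suc Q
      1≤W = 1≤^ℕ (suc Q) 1≤w
      0≤W = ≤-trans (inj₁ 0<1) 1≤W
      1≤b : 1# ≤ b
      1≤b = ≤-trans 1≤W (≤-trans (x≤x*y 0≤W 1≤a) w^Qa≤b)
      scale : ∀ z → RationalPowers a α z → z * w ≤ b ^ α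
      scale z (0≤z , p , q , p≤qα , z^q≤a^p) with suc q ℕ.≤? p ℕ.* suc Q
      ... | yes q≤pQ = ≤-^ 1≤b 0<α (0≤* 0≤z (inj₁ 0<w) , p ℕ.* suc Q , Q ℕ.+ q ℕ.* suc Q , (begin
        fromℕ (p ℕ.* suc Q)                  ≈⟨ fromℕ-* p (suc Q) ⟩
        fromℕ p * fromℕ (suc Q)              ≤⟨ *-monoˡ-≤ (0≤fromℕ (suc Q)) p≤qα ⟩
        fromℕ (suc q) * α * fromℕ (suc Q)
          ≈⟨ solve 3 (λ q α Q → q :* α :* Q := q :* Q :* α) refl (fromℕ (suc q)) α (fromℕ (suc Q)) ⟩
        fromℕ (suc q) * fromℕ (suc Q) * α    ≈⟨ *-congʳ (fromℕ-* (suc q) (suc Q)) ⟨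
        fromℕ (suc q ℕ.* suc Q) * α          ∎) , (begin
        (z * w) ^ℕ (suc q ℕ.* suc Q)                      ≈⟨ ^-distrib-* z w (suc q ℕ.* suc Q) ⟩
        z ^ℕ (suc q ℕ.* suc Q) * w ^ℕ (suc q ℕ.* suc Q)   ≈⟨ *-cong (^-assocʳ z (suc q) (suc Q))
                                                              (trans (^-assocʳ w (suc Q) (suc q)) (reflexive (≡.cong (w ^ℕ_) (ℕ.*-comm (suc Q) (suc q))))) ⟨
        (z ^ℕ suc q) ^ℕ suc Q * W ^ℕ suc q                ≤⟨ *-mono-≤ (0≤^ℕ (suc Q) (0≤^ℕ p 0≤a)) (0≤^ℕ (suc q) 0≤W)
                                                              (^ℕ-monoˡ-≤ (suc Q) (0≤^ℕ (suc q) 0≤z) z^q≤a^p) (^ℕ-monoʳ-≤ 1≤W q≤pQ) ⟩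
        (a ^ℕ p) ^ℕ suc Q * W ^ℕ (p ℕ.* suc Q)            ≈⟨ *-congʳ (^-assocʳ a p (suc Q)) ⟩
        a ^ℕ (p ℕ.* suc Q) * W ^ℕ (p ℕ.* suc Q)           ≈⟨ trans (*-comm _ _) (sym (^-distrib-* W a (p ℕ.* suc Q))) ⟩
        (W * a) ^ℕ (p ℕ.* suc Q)                          ≤⟨ ^ℕ-monoˡ-≤ (p ℕ.* suc Q) (0≤* 0≤W 0≤a) w^Qa≤b ⟩
        b ^ℕ (p ℕ.* suc Q)                                ∎))
      -- The exponent `p / suc q` is now below `1 / suc Q`. It is raised to `1 / suc Q`, still at
      -- most `α`, where the hypothesis on `w` applies directly.
      ... | no q≰pQ = root≤^ 1≤b 0<α Q (0≤* 0≤z (inj₁ 0<w)) 1≤Qα (begin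
        (z * w) ^ℕ suc Q      ≈⟨ ^-distrib-* z w (suc Q) ⟩
        z ^ℕ suc Q * W        ≤⟨ *-monoˡ-≤ 0≤W z^Q≤a ⟩
        a * W                 ≈⟨ *-comm a W ⟩
        W * a                 ≤⟨ w^Qa≤b ⟩
        b                     ∎)
        where
        z^Q≤a : z ^ℕ suc Q ≤ a
        z^Q≤a = ^ℕ-cancel-≤ q 0≤a (begin
          (z ^ℕ suc Q) ^ℕ suc q
            ≈⟨ trans (^-assocʳ z (suc Q) (suc q)) (trans (reflexive (≡.cong (z ^ℕ_) (ℕ.*-comm (suc Q) (suc q))))
                                      (sym (^-assocʳ z (suc q) (suc Q)))) ⟩
          (z ^ℕ suc q) ^ℕ suc Q  ≤⟨ ^ℕ-monoˡ-≤ (suc Q) (0≤^ℕ (suc q) 0≤z) z^q≤a^p ⟩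
          (a ^ℕ p) ^ℕ suc Q      ≈⟨ ^-assocʳ a p (suc Q) ⟩
          a ^ℕ (p ℕ.* suc Q)     ≤⟨ ^ℕ-monoʳ-≤ 1≤a (ℕ.<⇒≤ (ℕ.≰⇒> q≰pQ)) ⟩
          a ^ℕ suc q             ∎)

  open OrderedField

  -- Base-2 logarithms, bit lengths and sub-polynomial functions.

  module Logarithms where
    open ≤-Reasoning

    2ᴿ : ℝ
    2ᴿ = fromℕ 2

    0<2 : 0# < 2ᴿ
    0<2 = <-≤-trans 0<1 1≤2

    0≤2 : 0# ≤ 2ᴿ
    0≤2 = inj₁ 0<2

    -- A rational power of 2 with exponent at least 1 is halved, which lowers its exponent by 1 into
    -- the range of `r`; one with exponent below 1 is at most 2.
    double-pow≥1 : ∀ {a r} (0≤r : 0# ≤ r) (0≤r+1 : 0# ≤ r + 1#) → 1# ≤ a →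
      pow≥1 1≤2 0≤r ≤ a → pow≥1 1≤2 0≤r+1 ≤ 2ᴿ * a
    double-pow≥1 {a} {r} 0≤r 0≤r+1 1≤a 2^r≤a = supremum-≤ (proj₂ (pow≥1-sup 1≤2 0≤r+1)) λ
      { z (0≤z , p , q , p≤q[r+1] , z^q≤2^p) → halve z 0≤z p q p≤q[r+1] z^q≤2^p }
      where
      halve : ∀ z → 0# ≤ z → ∀ p q → fromℕ p ≤ fromℕ (suc q) * (r + 1#) → z ^ℕ suc q ≤ 2ᴿ ^ℕ p → z ≤ 2ᴿ * a
      halve z 0≤z p q p≤q[r+1] z^q≤2^p with suc q ℕ.≤? p
      ... | no q≰p = ≤-trans (^ℕ-cancel-≤ q 0≤2 (≤-trans z^q≤2^p (^ℕ-monoʳ-≤ 1≤2 (ℕ.<⇒≤ (ℕ.≰⇒> q≰p))))) (x≤x*y 0≤2 1≤a)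
      ... | yes q≤p = begin
        z                ≈⟨ *-⁻¹-cancelʳ 0<2 ⟨
        z * 2ᴿ ⁻¹ * 2ᴿ   ≤⟨ *-monoˡ-≤ 0≤2 (≤-trans (proj₁ (proj₂ (pow≥1-sup 1≤2 0≤r)) _ candidate) 2^r≤a) ⟩
        a * 2ᴿ           ≈⟨ *-comm a 2ᴿ ⟩
        2ᴿ * a           ∎
        where
        d = p ℕ.∸ suc q
        d+q≡p : d ℕ.+ suc q ≡ p
        d+q≡p = ℕ.m∸n+n≡m q≤p
        candidate : RationalPowers 2ᴿ r (z * 2ᴿ ⁻¹)
        candidate = 0≤* 0≤z (inj₁ (0<⁻¹ 0<2)) , d , q ,
          +-cancelʳ-≤ (fromℕ (suc q)) (begin
            fromℕ d + fromℕ (suc q)            ≈⟨ fromℕ-+ d (suc q) ⟨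
            fromℕ (d ℕ.+ suc q)                ≡⟨ ≡.cong fromℕ d+q≡p ⟩
            fromℕ p                            ≤⟨ p≤q[r+1] ⟩
            fromℕ (suc q) * (r + 1#)           ≈⟨ trans (distribˡ _ r 1#) (+-congˡ (*-identityʳ _)) ⟩
            fromℕ (suc q) * r + fromℕ (suc q)  ∎) ,
          *-cancelʳ-≤ (0<^ℕ (suc q) 0<2) (begin
            (z * 2ᴿ ⁻¹) ^ℕ suc q * 2ᴿ ^ℕ suc q  ≈⟨ ^-distrib-* (z * 2ᴿ ⁻¹) 2ᴿ (suc q) ⟨
            (z * 2ᴿ ⁻¹ * 2ᴿ) ^ℕ suc q           ≈⟨ ^-congˡ (suc q) (*-⁻¹-cancelʳ 0<2) ⟩
            z ^ℕ suc q                          ≤⟨ z^q≤2^p ⟩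
            2ᴿ ^ℕ p                             ≡⟨ ≡.cong (2ᴿ ^ℕ_) d+q≡p ⟨
            2ᴿ ^ℕ (d ℕ.+ suc q)                 ≈⟨ ^-homo-* 2ᴿ d (suc q) ⟩
            2ᴿ ^ℕ d * 2ᴿ ^ℕ suc q               ∎)

    -- Otherwise some candidate `r` for `log₂ a` would exceed `log₂ b - 1`, although `r + 1` is a
    -- candidate for `log₂ b`.
    log₂-double : ∀ {a b} (1≤a : 1# ≤ a) (1≤b : 1# ≤ b) → 2ᴿ * a ≤ b → log₂ 1≤a + 1# ≤ log₂ 1≤b
    log₂-double {a} {b} 1≤a 1≤b 2a≤b = ≮⇒≥ λ log-b<log-a+1 →
      let r , (0≤r , 2^r≤a) , below = proj₂ (proj₂ (log₂-sup 1≤a)) (log₂ 1≤b + - 1#)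
            (+-cancelʳ-< 1# (<-respˡ-≈ (sym (trans (+-assoc _ _ _) (trans (+-congˡ (-‿inverseˡ 1#)) (+-identityʳ _)))) log-b<log-a+1))
          0≤r+1 = 0≤+ 0≤r (inj₁ 0<1)
      in ≤⇒≯ (proj₁ (proj₂ (log₂-sup 1≤b)) (r + 1#) (0≤r+1 , ≤-trans (double-pow≥1 0≤r 0≤r+1 1≤a 2^r≤a) 2a≤b))
           (<-respˡ-≈ (trans (+-assoc _ _ _) (trans (+-congˡ (-‿inverseˡ 1#)) (+-identityʳ _))) (+-monoˡ-< 1# below))

    log₂-< : ∀ {a} K (1≤a : 1# ≤ a) → a < 2ᴿ ^ℕ K → log₂ 1≤a ≤ fromℕ K
    log₂-< {a} K 1≤a a<2^K = supremum-≤ (proj₂ (log₂-sup 1≤a)) λ { r (0≤r , 2^r≤a) → ≮⇒≥ λ K<r →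
      ≤⇒≯ (≤-trans (proj₁ (proj₂ (pow≥1-sup 1≤2 0≤r)) (2ᴿ ^ℕ K)
        ( 0≤^ℕ K 0≤2 , K , 0 , inj₁ (<-respʳ-≈ (sym (trans (*-congʳ fromℕ-1) (*-identityˡ r))) K<r)
        , inj₂ (*-identityʳ _))) 2^r≤a) a<2^K }

    1≤log₂ : ∀ {a} (1≤a : 1# ≤ a) → 2ᴿ ≤ a → 1# ≤ log₂ 1≤a
    1≤log₂ {a} 1≤a 2≤a = proj₁ (proj₂ (log₂-sup 1≤a)) 1# (inj₁ 0<1 ,
      ≤-trans (supremum-≤ (proj₂ (pow≥1-sup 1≤2 (inj₁ 0<1))) λ { z (0≤z , p , q , p≤q , z^q≤2^p) →
        ^ℕ-cancel-≤ q 0≤2 (≤-trans z^q≤2^p (^ℕ-monoʳ-≤ 1≤2 (fromℕ-cancel-≤ {p} {suc q} (≤-trans p≤q (inj₂ (*-identityʳ _)))))) }) 2≤a)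

    bitLength-spec : ∀ t N → t < 2ᴿ ^ℕ N → ∃[ k ] t < 2ᴿ ^ℕ k × (∀ {j} → j ℕ.< k → 2ᴿ ^ℕ j ≤ t)
    bitLength-spec t zero    t<1 = 0 , t<1 , λ ()
    bitLength-spec t (suc N) t<2^N+1 with compare t (2ᴿ ^ℕ N)
    ... | tri< t<2^N _ _ = bitLength-spec t N t<2^N
    ... | tri≈ t≮2^N _ _ = suc N , t<2^N+1 , λ { (s≤s j≤N) → ≤-trans (^ℕ-monoʳ-≤ 1≤2 j≤N) (≮⇒≥ t≮2^N) }
    ... | tri> t≮2^N _ _ = suc N , t<2^N+1 , λ { (s≤s j≤N) → ≤-trans (^ℕ-monoʳ-≤ 1≤2 j≤N) (≮⇒≥ t≮2^N) }

    <2^ : ∀ t → ∃[ N ] t < 2ᴿ ^ℕ N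
    <2^ t with archimedean t
    ... | N , t≤N = suc N , ≤-<-trans t≤N (<-≤-trans (fromℕ-mono-< (ℕ.n<1+n N)) (fromℕ≤2^ (suc N)))

    bitLength-exists : ∀ t → ∃[ k ] t < 2ᴿ ^ℕ k × (∀ {j} → j ℕ.< k → 2ᴿ ^ℕ j ≤ t)
    bitLength-exists t = let N , t<2^N = <2^ t in bitLength-spec t N t<2^N

    abstract
      -- The least `k` with `t < 2 ^ k`, an integer stand-in for the logarithm. Being abstract, it
      -- is accessible only through the two properties that follow.
      bitLength : ℝ → ℕ
      bitLength t = proj₁ (bitLength-exists t)

      <2^bitLength : ∀ t → t < 2ᴿ ^ℕ bitLength t
      <2^bitLength t = proj₁ (proj₂ (bitLength-exists t))

      <bitLength⇒2^≤ : ∀ t {j} → j ℕ.< bitLength t → 2ᴿ ^ℕ j ≤ t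
      <bitLength⇒2^≤ t = proj₂ (proj₂ (bitLength-exists t))

    <2^⇒bitLength≤ : ∀ {t k} → t < 2ᴿ ^ℕ k → bitLength t ℕ.≤ k
    <2^⇒bitLength≤ {t} t<2^k = ℕ.≮⇒≥ λ k<lg → ≤⇒≯ (<bitLength⇒2^≤ t k<lg) t<2^k

    2^≤⇒<bitLength : ∀ {t k} → 2ᴿ ^ℕ k ≤ t → k ℕ.< bitLength t
    2^≤⇒<bitLength {t} 2^k≤t = ℕ.≰⇒> λ lg≤k → ≤⇒≯ (≤-trans (^ℕ-monoʳ-≤ 1≤2 lg≤k) 2^k≤t) (<2^bitLength t)

    bitLength-mono-≤ : ∀ {s t} → s ≤ t → bitLength s ℕ.≤ bitLength t
    bitLength-mono-≤ s≤t = <2^⇒bitLength≤ (≤-<-trans s≤t (<2^bitLength _))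

    bitLength-cong : ∀ {s t} → s ≈ t → bitLength s ≡ bitLength t
    bitLength-cong s≈t = ℕ.≤-antisym (bitLength-mono-≤ (inj₂ s≈t)) (bitLength-mono-≤ (inj₂ (sym s≈t)))

    -- A rounded `c * log t`; the `suc` keeps it invertible for `c ≥ 1` even when `t < 1` and the
    -- bit length is 0.
    logarithmic : ℕ → ℝ → ℝ
    logarithmic c t = fromℕ (c ℕ.* suc (bitLength t))

    logarithmic-mono-≤ : ∀ c {s t} → s ≤ t → logarithmic c s ≤ logarithmic c t
    logarithmic-mono-≤ c s≤t = fromℕ-mono-≤ (ℕ.*-monoʳ-≤ c (s≤s (bitLength-mono-≤ s≤t)))

    -- If the bit length of `t` lies in block `i` of length `suc q`, then `t ^ α ≥ 2 ^ i`, while the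
    -- left side is at most linear in `suc i`.
    logarithmic≤^ : ∀ c {α} → 0# < α → ∃[ X ] 1# ≤ X × (∀ t → X ≤ t → logarithmic c t ≤ t ^ α)
    logarithmic≤^ c {α} 0<α with reciprocal-bound 0<α
    ... | q , 1≤qα with polynomial≤2^ (c ℕ.* suc (suc q)) 1
    ...   | i₀ , bound = X , 1≤X , below
      where
      X = 2ᴿ ^ℕ (suc q ℕ.* i₀)
      1≤X = 1≤^ℕ (suc q ℕ.* i₀) 1≤2
      below : ∀ t → X ≤ t → logarithmic c t ≤ t ^ α
      below t X≤t with block q (2^≤⇒<bitLength X≤t)
      ... | i , i₀≤i , qi<lg , lg≤q[1+i] = begin
        fromℕ (c ℕ.* suc (bitLength t))  ≤⟨ fromℕ-mono-≤ poly ⟩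
        fromℕ (2 ℕ.^ i)                  ≈⟨ fromℕ-^ 2 i ⟩
        2ᴿ ^ℕ i                          ≤⟨ root≤^ (≤-trans 1≤X X≤t) 0<α q (0≤^ℕ i 0≤2) 1≤qα root ⟩
        t ^ α                            ∎
        where
        root : (2ᴿ ^ℕ i) ^ℕ suc q ≤ t
        root = begin
          (2ᴿ ^ℕ i) ^ℕ suc q    ≈⟨ ^-assocʳ 2ᴿ i (suc q) ⟩
          2ᴿ ^ℕ (i ℕ.* suc q)   ≡⟨ ≡.cong (2ᴿ ^ℕ_) (ℕ.*-comm i (suc q)) ⟩
          2ᴿ ^ℕ (suc q ℕ.* i)   ≤⟨ <bitLength⇒2^≤ t qi<lg ⟩
          t                     ∎
        poly : c ℕ.* suc (bitLength t) ℕ.≤ 2 ℕ.^ i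
        poly = ℕ.≤-trans (ℕ.*-monoʳ-≤ c (ℕ.+-mono-≤ (s≤s (z≤n {i})) lg≤q[1+i])) (ℕ.≤-trans (ℕ.≤-reflexive
          (≡.trans (≡.sym (ℕ.*-assoc c (suc (suc q)) (suc i))) (≡.cong (c ℕ.* suc (suc q) ℕ.*_) (≡.sym (ℕ.*-identityʳ (suc i))))))
          (bound i i₀≤i))

    fromℕ-*-logarithmic : ∀ m c t → fromℕ m * logarithmic c t ≈ logarithmic (m ℕ.* c) t
    fromℕ-*-logarithmic m c t = trans (sym (fromℕ-* m (c ℕ.* suc (bitLength t))))
      (reflexive (≡.cong fromℕ (≡.sym (ℕ.*-assoc m c (suc (bitLength t))))))

    multiple-logarithmic≤^ : ∀ m c {α} → 0# < α →
      ∃[ X ] 1# ≤ X × (∀ t → X ≤ t → fromℕ m * logarithmic c t ≤ t ^ α)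
    multiple-logarithmic≤^ m c 0<α =
      let X , 1≤X , below = logarithmic≤^ (m ℕ.* c) 0<α
      in X , 1≤X , λ t X≤t → ≤-trans (inj₂ (fromℕ-*-logarithmic m c t)) (below t X≤t)

    module _ {c : ℕ} (1≤c : 1 ℕ.≤ c) where

      1≤logarithmic : ∀ t → 1# ≤ logarithmic c t
      1≤logarithmic t = 1≤fromℕ (ℕ.≤-trans 1≤c (ℕ.m≤m*n c (suc (bitLength t))))

      0<logarithmic : ∀ t → 0# < logarithmic c t
      0<logarithmic t = <-≤-trans 0<1 (1≤logarithmic t)

      logarithmic-vanishes : ∀ α → 0# < α → ∀ δ → 0# < δ →
        ∃[ X ] 1# ≤ X × (∀ t → X ≤ t → t ^ (- α) * logarithmic c t < δ)
      logarithmic-vanishes α 0<α δ 0<δ =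
        let N , δ⁻¹≤N = archimedean (δ ⁻¹)
            X , 1≤X , below = multiple-logarithmic≤^ (suc N) c 0<α
        in X , 1≤X , λ t X≤t → vanish N δ⁻¹≤N t (≤-trans 1≤X X≤t) (below t X≤t)
        where
        vanish : ∀ N → δ ⁻¹ ≤ fromℕ N → ∀ t → 1# ≤ t → fromℕ (suc N) * logarithmic c t ≤ t ^ α →
          t ^ (- α) * logarithmic c t < δ
        vanish N δ⁻¹≤N t 1≤t below = *-cancelʳ-< (0≤fromℕ (suc N)) (begin-strict
          t ^ (- α) * logarithmic c t * fromℕ (suc N)    ≈⟨ trans (*-assoc _ _ _) (*-congˡ (*-comm _ _)) ⟩
          t ^ (- α) * (fromℕ (suc N) * logarithmic c t)  ≤⟨ *-monoʳ-≤ (inj₁ (0<^-neg 1≤t 0<α)) below ⟩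
          t ^ (- α) * t ^ α                              ≈⟨ *-congʳ (^-neg 1≤t 0<α) ⟩
          (t ^ α) ⁻¹ * t ^ α                             ≈⟨ ⁻¹-inverseˡ (0<^ 1≤t 0<α) ⟩
          1#                                             ≈⟨ ⁻¹-inverseʳ (0<⇒≉0 0<δ) ⟨
          δ * δ ⁻¹                                       <⟨ *-monoʳ-< 0<δ (≤-<-trans δ⁻¹≤N (fromℕ-mono-< (ℕ.n<1+n N))) ⟩
          δ * fromℕ (suc N)                              ∎)

      logarithmic-isSubPolynomial : ∀ {Domain : Set} (ι : Domain → ℝ) → IsSubPolynomial ι (λ x → logarithmic c (ι x))
      logarithmic-isSubPolynomial ι = record
        { cong        = λ ιx≈ιy → reflexive (≡.cong (λ k → fromℕ (c ℕ.* suc k)) (bitLength-cong ιx≈ιy))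
        ; nonNegative = λ x → inj₁ (0<logarithmic (ι x))
        ; x^αf→∞      = λ α 0<α B →
            let N , B≤N = archimedean B
                X , 1≤X , below = logarithmic≤^ N 0<α
            in X , λ x X≤x → let t = ι x in begin
              B                                ≤⟨ B≤N ⟩
              fromℕ N                          ≤⟨ fromℕ-mono-≤ (ℕ.m≤m*n N (suc (bitLength t))) ⟩
              logarithmic N t                  ≤⟨ below t X≤x ⟩
              t ^ α                            ≤⟨ x≤x*y (inj₁ (0<^ (≤-trans 1≤X X≤x) 0<α)) (1≤logarithmic t) ⟩
              t ^ α * logarithmic c t    ∎
        ; x^-αf→0     = λ α 0<α δ 0<δ →
            let X , 1≤X , below = logarithmic-vanishes α 0<α δ 0<δ
            in X , λ x X≤x → <-respˡ-≈
              (sym (0≤⇒∣∣≈ (0≤* (inj₁ (0<^-neg (≤-trans 1≤X X≤x) 0<α)) (inj₁ (0<logarithmic (ι x))))))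
              (below (ι x) X≤x)
        }

      logarithmic⁻¹-isSubPolynomial : ∀ {Domain : Set} (ι : Domain → ℝ) → IsSubPolynomial ι (λ x → logarithmic c (ι x) ⁻¹)
      logarithmic⁻¹-isSubPolynomial ι = record
        { cong        = λ ιx≈ιy → reflexive (≡.cong (λ k → fromℕ (c ℕ.* suc k) ⁻¹) (bitLength-cong ιx≈ιy))
        ; nonNegative = λ x → inj₁ (0<⁻¹ (0<logarithmic (ι x)))
        ; x^αf→∞      = λ α 0<α B →
            let N , B≤N = archimedean B
                X , 1≤X , below = multiple-logarithmic≤^ (suc N) c 0<α
            in X , λ x X≤x → *≤⇒≤/ (0<logarithmic (ι x))
              (≤-trans (*-monoˡ-≤ (inj₁ (0<logarithmic (ι x))) (≤-trans B≤N (≤-+ˡ (inj₁ 0<1)))) (below (ι x) X≤x))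
        ; x^-αf→0     = λ α 0<α δ 0<δ →
            let X , 1≤X , below = logarithmic-vanishes α 0<α δ 0<δ
            in X , λ x X≤x → let t = ι x ; 0<t^-α = 0<^-neg (≤-trans 1≤X X≤x) 0<α in begin-strict
              ∣ t ^ (- α) * logarithmic c t ⁻¹ ∣  ≈⟨ 0≤⇒∣∣≈ (0≤* (inj₁ 0<t^-α) (inj₁ (0<⁻¹ (0<logarithmic t)))) ⟩
              t ^ (- α) * logarithmic c t ⁻¹      ≤⟨ *-monoʳ-≤ (inj₁ 0<t^-α) (⁻¹≤ (1≤logarithmic t)) ⟩
              t ^ (- α) * logarithmic c t         <⟨ below t X≤x ⟩
              δ                                         ∎
        }
        where
        ⁻¹≤ : ∀ {x} → 1# ≤ x → x ⁻¹ ≤ x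
        ⁻¹≤ {x} 1≤x = begin
          x ⁻¹       ≤⟨ x≤x*y (inj₁ (0<⁻¹ (<-≤-trans 0<1 1≤x))) 1≤x ⟩
          x ⁻¹ * x   ≈⟨ ⁻¹-inverseˡ (<-≤-trans 0<1 1≤x) ⟩
          1#         ≤⟨ 1≤x ⟩
          x          ∎

      -- Admits a precision of order `1 / log y` in near periodicity, the same order as the relative
      -- growth of `log^η`.
      logarithmic⁻¹∈𝕊 : 𝕊 (λ n → logarithmic c (fromℕ n) ⁻¹)
      logarithmic⁻¹∈𝕊 = logarithmic⁻¹-isSubPolynomial fromℕ , λ m≤n → ⁻¹-antitone (0<logarithmic _)
        (logarithmic-mono-≤ c (fromℕ-mono-≤ m≤n))

  open Logarithms

  -- From a one-pass algorithm to a protocol for INDEX.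

  module Reduction where

    module Runs {n} (A : Algorithm 1 n) where
      open Algorithm A

      -- A copy of `process` with no lengths in its type, so that a run can be cut between Alice and
      -- Bob. The last clause covers the end of the input and, by default, a shortage of coins.
      processList : List (Fin 1 × Update n) → List Draw → Memory → Memory
      processList ((pass , u) ∷ w) (d ∷ ds) s = processList w ds (step pass u d s)
      processList _                _        s = s

      process≡processList : ∀ w (ds : Vec Draw (length w)) s → process w ds s ≡ processList w (toList ds) s
      process≡processList []      []       s = ≡.refl
      process≡processList (_ ∷ w) (d ∷ ds) s = process≡processList w ds _

      processList-[] : ∀ w s → processList w [] s ≡ s
      processList-[] []      s = ≡.refl
      processList-[] (_ ∷ _) s = ≡.refl

      processList-++ : ∀ v w ds s →
        processList (v ++ w) ds s ≡ processList w (drop (length v) ds) (processList v ds s)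
      processList-++ []      w ds       s = ≡.refl
      processList-++ (_ ∷ v) w []       s = ≡.sym (processList-[] w s)
      processList-++ (_ ∷ v) w (d ∷ ds) s = processList-++ v w ds _

      input-single-pass : ∀ D → input D ≡ map (zero ,_) D
      input-single-pass D = ++-identityʳ _

      length-input : ∀ D → length (input D) ≡ length D
      length-input D = ≡.trans (cong length (input-single-pass D)) (length-map _ D)

      -- Unlike run, the type of the coin vector does not depend on the stream.
      runWith : ∀ {N} → Stream n → Vec Draw (2 ℕ.+ N) → ℝ
      runWith D (d₀ ∷ d₁ ∷ ds) = output d₁ (processList (map (zero ,_) D) (toList ds) (init d₀))

      run≡runWith : ∀ D ω → run D ω ≡ runWith D ω
      run≡runWith D (d₀ ∷ d₁ ∷ ds) = cong (output d₁) (≡.trans (process≡processList (input D) ds (init d₀))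
        (cong (λ w → processList w (toList ds) (init d₀)) (input-single-pass D)))

      Probability≥-runWith : ∀ a b (E : Pred ℝ 0ℓ) D {N} → length D ≡ N →
        Probability≥ a b (λ ω → E (run D ω)) → Probability≥ {ℓ = 2 ℕ.+ N} a b (λ ω → E (runWith D ω))
      Probability≥-runWith a b E D ∣D∣≡N = transport (≡.trans (length-input D) ∣D∣≡N)
        where
        transport : ∀ {N} → length (input D) ≡ N →
          Probability≥ a b (λ ω → E (run D ω)) → Probability≥ {ℓ = 2 ℕ.+ N} a b (λ ω → E (runWith D ω))
        transport ≡.refl (outcomes , unique , allE , large) =
          outcomes , unique , All.map (λ {ω} → subst E (run≡runWith D ω)) allE , large

    sum-≤-fromℕ : ∀ {n} (v : Fin n → ℝ) {d} → (∀ i → v i ≤ d) → sum v ≤ fromℕ n * d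
    sum-≤-fromℕ {zero}  v v≤d = inj₂ (sym (zeroˡ _))
    sum-≤-fromℕ {suc n} v {d} v≤d = ≤-trans (+-mono-≤ (v≤d zero) (sum-≤-fromℕ (v ∘ suc) (v≤d ∘ suc)))
      (inj₂ (sym (trans (distribʳ d 1# _) (+-congʳ (*-identityˡ d)))))

    sum-≤-except : ∀ {n} (v : Fin n → ℝ) i {c d} → 0# ≤ d → v i ≤ c → (∀ j → j ≢ i → v j ≤ d) → sum v ≤ c + fromℕ n * d
    sum-≤-except {suc n} v zero {c} {d} 0≤d vi≤c v≤d = +-mono-≤ vi≤c (begin
      sum (v ∘ suc)        ≤⟨ sum-≤-fromℕ (v ∘ suc) (λ j → v≤d (suc j) (λ ())) ⟩
      fromℕ n * d          ≤⟨ *-monoˡ-≤ 0≤d (≤-+ˡ (inj₁ 0<1)) ⟩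
      fromℕ (suc n) * d    ∎)
      where open ≤-Reasoning
    sum-≤-except {suc n} v (suc i) {c} {d} 0≤d vi≤c v≤d = begin
      v zero + sum (v ∘ suc)    ≤⟨ +-mono-≤ (v≤d zero (λ ())) (sum-≤-except (v ∘ suc) i 0≤d vi≤c
                                     (λ j j≢i → v≤d (suc j) (j≢i ∘ Fin.suc-injective))) ⟩
      d + (c + fromℕ n * d)     ≈⟨ solve 3 (λ d c n → d :+ (c :+ n :* d) := c :+ (con 1 :+ n) :* d) refl d c (fromℕ n) ⟩
      c + fromℕ (suc n) * d     ∎
      where open ≤-Reasoning

    0≤sum : ∀ {n} (v : Fin n → ℝ) → (∀ i → 0# ≤ v i) → 0# ≤ sum v
    0≤sum {zero}  v 0≤v = ≤-refl
    0≤sum {suc n} v 0≤v = 0≤+ (0≤v zero) (0≤sum (v ∘ suc) (0≤v ∘ suc))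

    ≤sum : ∀ {n} (v : Fin n → ℝ) i → (∀ i → 0# ≤ v i) → v i ≤ sum v
    ≤sum v zero    0≤v = ≤-+ʳ (0≤sum (v ∘ suc) (0≤v ∘ suc))
    ≤sum v (suc i) 0≤v = ≤-trans (≤sum (v ∘ suc) i (0≤v ∘ suc)) (≤-+ˡ (0≤v zero))

    exceeds : ℝ → ℝ → Bool
    exceeds θ r with compare θ r
    ... | tri< _ _ _ = true
    ... | tri≈ _ _ _ = false
    ... | tri> _ _ _ = false

    exceeds-true : ∀ {θ r} → θ < r → exceeds θ r ≡ true
    exceeds-true {θ} {r} θ<r with compare θ r
    ... | tri< _ _ _   = ≡.refl
    ... | tri≈ θ≮r _ _ = contradiction θ<r θ≮r
    ... | tri> θ≮r _ _ = contradiction θ<r θ≮r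

    exceeds-false : ∀ {θ r} → r ≤ θ → exceeds θ r ≡ false
    exceeds-false {θ} {r} r≤θ with compare θ r
    ... | tri< θ<r _ _ = contradiction θ<r (≤⇒≯ r≤θ)
    ... | tri≈ _ _ _   = ≡.refl
    ... | tri> _ _ _   = ≡.refl

    -- Alice encodes her bits as frequencies 0 and y, and Bob adds x to the coordinate he queries.
    module IndexProtocol {n : ℕ} (x y : ℕ) where

      aliceWeight : Vec Bool n → Fin n → ℕ
      aliceWeight as i = if lookup as i then y else 0

      alice : Vec Bool n → List (Fin n × ℕ)
      alice as = map (λ i → i , aliceWeight as i) (allFin n)

      length-alice : ∀ as → length (alice as) ≡ n
      length-alice as = ≡.trans (length-map _ (allFin n)) (length-tabulate {n = n} (λ i → i))

      updates : Vec Bool n → Fin n → List (Fin n × ℕ)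
      updates as b = alice as ++ (b , x) ∷ []

      stream : Vec Bool n → Fin n → Stream n
      stream as b = map insert (updates as b)

      length-stream : ∀ as b → length (stream as b) ≡ n ℕ.+ 1
      length-stream as b = ≡.trans (length-map insert (updates as b))
        (≡.trans (length-++ (alice as)) (cong (ℕ._+ 1) (length-alice as)))

      total : ∀ as b i → sumOver (updates as b) (weightAt i) ≡ aliceWeight as i ℕ.+ weightAt i (b , x)
      total as b i = ≡.trans (sumOver-++ (alice as) ((b , x) ∷ []) (weightAt i)) (≡.cong₂ ℕ._+_
        (≡.trans (cong Data.Nat.ListAction.sum (≡.sym (map-∘ (allFin n)))) (sumOver-select (aliceWeight as) (allFin⁺ n) (∈-allFin i)))
        (ℕ.+-identityʳ _))

      frequency-stream : ∀ as b i → ℤ.∣ frequency (stream as b) i ∣ ≡ aliceWeight as i ℕ.+ weightAt i (b , x)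
      frequency-stream as b i = ≡.trans (cong ℤ.∣_∣ (frequency-inserts (updates as b) i)) (total as b i)

      frequency-at : ∀ as b → ℤ.∣ frequency (stream as b) b ∣ ≡ aliceWeight as b ℕ.+ x
      frequency-at as b = ≡.trans (frequency-stream as b b)
        (cong (λ d → aliceWeight as b ℕ.+ (if d then x else 0)) (dec-true (b Fin.≟ b) ≡.refl))

      frequency-off : ∀ as b i → i ≢ b → ℤ.∣ frequency (stream as b) i ∣ ≡ aliceWeight as i
      frequency-off as b i i≢b = ≡.trans (frequency-stream as b i) (≡.trans
        (cong (λ d → aliceWeight as i ℕ.+ (if d then x else 0)) (dec-false (b Fin.≟ i) (i≢b ∘ ≡.sym)))
        (ℕ.+-identityʳ _))

      -- There are no deletions, so the frequencies of every prefix are dominated by the final ones.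
      stream∈𝒟 : ∀ {M} → x ℕ.+ y ℕ.≤ M → ∀ as b → 𝒟 M (n ℕ.+ 1) (stream as b)
      stream∈𝒟 {M} x+y≤M as b = ℕ.≤-reflexive (length-stream as b) , λ k i → begin
        ℤ.∣ frequency (take k (stream as b)) i ∣              ≡⟨ cong (λ D → ℤ.∣ frequency D i ∣) (take-map k (updates as b)) ⟩
        ℤ.∣ frequency (map insert (take k (updates as b))) i ∣ ≡⟨ cong ℤ.∣_∣ (frequency-inserts (take k (updates as b)) i) ⟩
        sumOver (take k (updates as b)) (weightAt i)          ≤⟨ sumOver-take k (updates as b) (weightAt i) ⟩
        sumOver (updates as b) (weightAt i)                   ≡⟨ total as b i ⟩
        aliceWeight as i ℕ.+ weightAt i (b , x)               ≤⟨ ℕ.+-mono-≤ (if≤ (lookup as i) y) (if≤ (does (b Fin.≟ i)) x) ⟩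
        y ℕ.+ x                                               ≡⟨ ℕ.+-comm y x ⟩
        x ℕ.+ y                                               ≤⟨ x+y≤M ⟩
        M                                                     ∎
        where
        open ℕ.≤-Reasoning
        if≤ : ∀ b w → (if b then w else 0) ℕ.≤ w
        if≤ true  w = ℕ.≤-refl
        if≤ false w = z≤n

      module _ {f : ℕ → ℝ} (f0≈0 : f 0 ≈ 0#) (0≤f : ∀ z → 0# ≤ f z) where

        gSum-≤ : ∀ as b → lookup as b ≡ false → gSum f (frequency (stream as b)) ≤ f x + fromℕ n * f y
        gSum-≤ as b as[b]≡false = sum-≤-except _ b (0≤f y)
          (inj₂ (reflexive (cong f (≡.trans (frequency-at as b) (cong (λ a → (if a then y else 0) ℕ.+ x) as[b]≡false)))))
          (λ i i≢b → ≤-trans (inj₂ (reflexive (cong f (frequency-off as b i i≢b)))) (f-if (lookup as i)))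
          where
          f-if : ∀ a → f (if a then y else 0) ≤ f y
          f-if true  = ≤-refl
          f-if false = ≤-trans (inj₂ f0≈0) (0≤f y)

        ≤-gSum : ∀ as b → lookup as b ≡ true → f (x ℕ.+ y) ≤ gSum f (frequency (stream as b))
        ≤-gSum as b as[b]≡true = ≤-trans
          (inj₂ (reflexive (cong f (≡.sym (≡.trans (frequency-at as b)
            (≡.trans (cong (λ a → (if a then y else 0) ℕ.+ x) as[b]≡true) (ℕ.+-comm y x)))))))
          (≤sum (λ i → f ℤ.∣ frequency (stream as b) i ∣) b (λ i → 0≤f _))

    module _ {k} (A : Algorithm 1 (3 ℕ.* k)) {f : ℕ → ℝ} (f0≈0 : f 0 ≈ 0#) (0≤f : ∀ z → 0# ≤ f z) where
      open Algorithm A using (space; Draw; Memory; init; step; output) renaming (k to r)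
      open Runs A

      module _ {ε θ x y M} (0≤1+ε : 0# ≤ 1# + ε) (0≤1-ε : 0# ≤ 1# + - ε)
        (below : (1# + ε) * (f x + fromℕ (3 ℕ.* k) * f y) ≤ θ) (above : θ < (1# + - ε) * f (x ℕ.+ y))
        (x+y≤M : x ℕ.+ y ℕ.≤ M) (solves : ∀ m D → 𝒟 M m D → SolvesSum f ε A D) where

        private
          n = 3 ℕ.* k
        open IndexProtocol {n} x y

        Coins : Set
        Coins = Vec Draw (2 ℕ.+ (n ℕ.+ 1))

        coins : List Coins
        coins = vectors (allFin (suc r)) (2 ℕ.+ (n ℕ.+ 1))

        0<∣coins∣ : 0 ℕ.< length coins
        0<∣coins∣ = ℕ.≤-trans (ℕ.m^n>0 (suc r) (2 ℕ.+ (n ℕ.+ 1)))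
          (ℕ.≤-reflexive (≡.sym (≡.trans (length-vectors (allFin (suc r)) (2 ℕ.+ (n ℕ.+ 1)))
            (cong (ℕ._^ (2 ℕ.+ (n ℕ.+ 1))) (length-tabulate {n = suc r} (λ i → i))))))

        pass : List (Fin n × ℕ) → List (Fin 1 × Update n)
        pass l = map (zero ,_) (map insert l)

        -- The coins are public: Bob gets the same vector and drops the first `n` update coins,
        -- already spent on Alice's part. The message is thus the memory alone.
        send : Coins → Vec Bool n → Memory
        send (d₀ ∷ d₁ ∷ ds) as = processList (pass (alice as)) (toList ds) (init d₀)

        answer : Coins → Memory → Fin n → ℝ
        answer (d₀ ∷ d₁ ∷ ds) s b = output d₁ (processList (pass ((b , x) ∷ [])) (drop n (toList ds)) s)

        answer≡runWith : ∀ ω as b → answer ω (send ω as) b ≡ runWith (stream as b) ω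
        answer≡runWith (d₀ ∷ d₁ ∷ ds) as b = cong (output d₁) (≡.sym (begin
          processList (pass (updates as b)) ds′ (init d₀)
            ≡⟨ cong (λ w → processList w ds′ (init d₀)) (≡.trans (cong (map (zero ,_)) (map-++ insert (alice as) bob))
                 (map-++ (zero ,_) (map insert (alice as)) (map insert bob))) ⟩
          processList (pass (alice as) ++ pass bob) ds′ (init d₀)
            ≡⟨ processList-++ (pass (alice as)) (pass bob) ds′ (init d₀) ⟩
          processList (pass bob) (drop (length (pass (alice as))) ds′) (send (d₀ ∷ d₁ ∷ ds) as)
            ≡⟨ cong (λ l → processList (pass bob) (drop l ds′) (send (d₀ ∷ d₁ ∷ ds) as))
                 (≡.trans (length-map _ (map insert (alice as))) (≡.trans (length-map insert (alice as)) (length-alice as))) ⟩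
          processList (pass bob) (drop n ds′) (send (d₀ ∷ d₁ ∷ ds) as) ∎))
          where
          open ≡.≡-Reasoning
          bob = (b , x) ∷ []
          ds′ = toList ds

        decode : Coins → Memory → Fin n → Bool
        decode ω s b = exceeds θ (answer ω s b)

        Accurate : Vec Bool n → Fin n → Pred ℝ 0ℓ
        Accurate as b r = (1# + - ε) * gSum f (frequency (stream as b)) ≤ r × r ≤ (1# + ε) * gSum f (frequency (stream as b))

        match-accurate : ∀ as b r → Accurate as b r → 1 ℕ.≤ match (lookup as b) (exceeds θ r)
        match-accurate as b r (lower , upper) with lookup as b in eq
        ... | true  rewrite exceeds-true {θ} {r} (<-≤-trans above (≤-trans (*-monoʳ-≤ 0≤1-ε (≤-gSum f0≈0 0≤f as b eq)) lower)) = s≤s z≤n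
        ... | false rewrite exceeds-false {θ} {r} (≤-trans upper (≤-trans (*-monoʳ-≤ 0≤1+ε (gSum-≤ f0≈0 0≤f as b eq)) below)) = s≤s z≤n

        decode-correct : ∀ as b → 2 ℕ.* length coins ℕ.≤ 3 ℕ.* sumOver coins (λ ω → match (lookup as b) (decode ω (send ω as) b))
        decode-correct as b = Probability≥⇒sumOver 2 3 _
          (λ {ω} → subst (λ r → 1 ℕ.≤ match (lookup as b) (exceeds θ r)) (≡.sym (answer≡runWith ω as b))
            ∘ match-accurate as b (runWith (stream as b) ω))
          (Probability≥-runWith 2 3 (Accurate as b) (stream as b) (length-stream as b)
            (solves (n ℕ.+ 1) (stream as b) (stream∈𝒟 x+y≤M as b)))

        space-bound : 32 ℕ.^ k ℕ.≤ 2 ℕ.^ space ℕ.* 27 ℕ.^ k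
        space-bound = index-bound coins 0<∣coins∣ k send decode decode-correct

  open Reduction

  -- The multiplicative gap between the values at `x` and `x + y`.

  module Separation where
    open ≤-Reasoning

    -- Each further factor at most triples the coefficient `c ≥ 1`, since
    -- `v + c * v + c * v * v ≤ 3 * c * v` for `v ≤ 1`.
    binomial-bound : ∀ q {v} → 0# ≤ v → v ≤ 1# → (1# + v) ^ℕ q ≤ 1# + fromℕ (3 ℕ.^ q) * v
    binomial-bound zero    {v} 0≤v v≤1 = ≤-+ʳ (0≤* (0≤fromℕ 1) 0≤v)
    binomial-bound (suc q) {v} 0≤v v≤1 = begin
      (1# + v) * (1# + v) ^ℕ q      ≤⟨ *-monoʳ-≤ (0≤+ (inj₁ 0<1) 0≤v) (binomial-bound q 0≤v v≤1) ⟩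
      (1# + v) * (1# + c * v)
        ≈⟨ solve 2 (λ v c → (con 1 :+ v) :* (con 1 :+ c :* v) := con 1 :+ (v :* con 1 :+ (c :* v :+ c :* v :* v))) refl v c ⟩
      1# + (v * 1# + (c * v + c * v * v))
        ≤⟨ +-monoʳ-≤ 1# (+-mono-≤ (*-monoʳ-≤ 0≤v 1≤c) (+-monoʳ-≤ (c * v) (*-monoʳ-≤ (0≤* 0≤c 0≤v) v≤1))) ⟩
      1# + (v * c + (c * v + c * v * 1#))
        ≈⟨ solve 2 (λ v c → con 1 :+ (v :* c :+ (c :* v :+ c :* v :* con 1)) :=
                            con 1 :+ numeral 3 :* c :* v) refl v c ⟩
      1# + fromℕ 3 * c * v          ≈⟨ +-congˡ (*-congʳ (fromℕ-* 3 (3 ℕ.^ q))) ⟨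
      1# + fromℕ (3 ℕ.^ suc q) * v  ∎
      where
      c = fromℕ (3 ℕ.^ q)
      1≤c : 1# ≤ c
      1≤c = 1≤fromℕ (ℕ.m^n>0 3 q)
      0≤c = ≤-trans (inj₁ 0<1) 1≤c

    -- `G` and `G'` are the values of `g`, `A` and `B` the logarithmic weights, at `x` and `x + y`.
    -- As `4 * u ≤ 1`, the product `(1 + 4u)(1 - u)` is at least `1 + 2u`, and `2u ≥ 8ε`.
    product-gap : ∀ {G G' A B u ε} → 0# ≤ G → 0# ≤ G' → 0# ≤ A → 0# ≤ u → fromℕ 4 * u ≤ 1# →
      fromℕ 4 * ε ≤ u → G ≤ G' + u * G → (1# + fromℕ 4 * u) * A ≤ B →
      (1# + fromℕ 8 * ε) * (G * A) ≤ G' * B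
    product-gap {G} {G'} {A} {B} {u} {ε} 0≤G 0≤G' 0≤A 0≤u 4u≤1 4ε≤u G≤G'+uG gain = begin
      (1# + fromℕ 8 * ε) * (G * A)
        ≈⟨ solve 3 (λ ε G A → (con 1 :+ numeral 8 :* ε) :* (G :* A) := (con 1 :+ numeral 2 :* (numeral 4 :* ε)) :* G :* A) refl ε G A ⟩
      (1# + fromℕ 2 * (fromℕ 4 * ε)) * G * A ≤⟨ *-monoˡ-≤ 0≤A (*-monoˡ-≤ 0≤G (+-monoʳ-≤ 1# (*-monoʳ-≤ (0≤fromℕ 2) 4ε≤u))) ⟩
      (1# + fromℕ 2 * u) * G * A            ≤⟨ *-monoˡ-≤ 0≤A cancelled ⟩
      (1# + fromℕ 4 * u) * G' * A           ≈⟨ solve 3 (λ c G A → c :* G :* A := G :* (c :* A)) refl (1# + fromℕ 4 * u) G' A ⟩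
      G' * ((1# + fromℕ 4 * u) * A)         ≤⟨ *-monoʳ-≤ 0≤G' gain ⟩
      G' * B                                ∎
      where
      0≤1+4u = 0≤+ (inj₁ 0<1) (0≤* (0≤fromℕ 4) 0≤u)
      cancelled : (1# + fromℕ 2 * u) * G ≤ (1# + fromℕ 4 * u) * G'
      cancelled = +-cancelʳ-≤ (fromℕ 2 * u * G) (begin
        (1# + fromℕ 2 * u) * G + fromℕ 2 * u * G
          ≈⟨ solve 2 (λ u G → (con 1 :+ numeral 2 :* u) :* G :+ numeral 2 :* u :* G := (con 1 :+ numeral 4 :* u) :* G) refl u G ⟩
        (1# + fromℕ 4 * u) * G                    ≤⟨ *-monoʳ-≤ 0≤1+4u G≤G'+uG ⟩
        (1# + fromℕ 4 * u) * (G' + u * G)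
          ≈⟨ trans (distribˡ _ G' _) (+-congˡ (solve 3 (λ c u G → (con 1 :+ c) :* (u :* G) := u :* G :* (con 1 :+ c)) refl (fromℕ 4 * u) u G)) ⟩
        (1# + fromℕ 4 * u) * G' + u * G * (1# + fromℕ 4 * u)  ≤⟨ +-monoʳ-≤ _ (*-monoʳ-≤ (0≤* 0≤u 0≤G) (+-monoʳ-≤ 1# 4u≤1)) ⟩
        (1# + fromℕ 4 * u) * G' + u * G * (1# + 1#)
          ≈⟨ +-congˡ (solve 2 (λ u G → u :* G :* (con 1 :+ con 1) := numeral 2 :* u :* G) refl u G) ⟩
        (1# + fromℕ 4 * u) * G' + fromℕ 2 * u * G ∎)

    -- `(1 - ε)(1 + 8ε)` exceeds `(1 + ε)(1 + ε)` once `9ε ≤ 1`. To avoid subtraction,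
    -- `ε (1 + 8ε) X` is added to both sides.
    relative-gap : ∀ {X W ε} → 0# < X → 0# < ε → fromℕ 16 * ε ≤ 1# → 0# ≤ 1# + - ε →
      (1# + fromℕ 8 * ε) * X ≤ W → (1# + ε) * ((1# + ε) * X) < (1# + - ε) * W
    relative-gap {X} {W} {ε} 0<X 0<ε 16ε≤1 0≤1-ε gap = <-≤-trans
      (+-cancelʳ-< (ε * ((1# + fromℕ 8 * ε) * X)) (begin-strict
        (1# + ε) * ((1# + ε) * X) + ε * ((1# + fromℕ 8 * ε) * X)
          ≈⟨ solve 2 (λ ε X → (con 1 :+ ε) :* ((con 1 :+ ε) :* X) :+ ε :* ((con 1 :+ numeral 8 :* ε) :* X) :=
                              (con 1 :+ (ε :+ ε :+ ε) :+ ε :* ((con 1 :+ numeral 8) :* ε)) :* X) refl ε X ⟩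
        (1# + (ε + ε + ε) + ε * ((1# + fromℕ 8) * ε)) * X
          ≤⟨ *-monoˡ-≤ (inj₁ 0<X) (+-monoʳ-≤ _ (*-monoʳ-≤ (inj₁ 0<ε) (≤-trans (*-monoˡ-≤ (inj₁ 0<ε) (fromℕ-mono-≤ {9} {16} (ℕ.m≤m+n 9 7))) 16ε≤1))) ⟩
        (1# + (ε + ε + ε) + ε * 1#) * X
          ≈⟨ solve 2 (λ ε X → (con 1 :+ (ε :+ ε :+ ε) :+ ε :* con 1) :* X := (con 1 :+ numeral 4 :* ε) :* X) refl ε X ⟩
        (1# + fromℕ 4 * ε) * X
          <⟨ *-monoˡ-< 0<X (+-monoʳ-< 1# (*-monoˡ-< 0<ε (fromℕ-mono-< {4} {8} (ℕ.m≤m+n 5 3)))) ⟩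
        (1# + fromℕ 8 * ε) * X
          ≈⟨ trans (sym (*-identityˡ _)) (*-congʳ (sym (trans (+-assoc 1# (- ε) ε) (trans (+-congˡ (-‿inverseˡ ε)) (+-identityʳ 1#))))) ⟩
        (1# + - ε + ε) * ((1# + fromℕ 8 * ε) * X)
          ≈⟨ distribʳ _ (1# + - ε) ε ⟩
        (1# + - ε) * ((1# + fromℕ 8 * ε) * X) + ε * ((1# + fromℕ 8 * ε) * X) ∎))
      (*-monoʳ-≤ 0≤1-ε gap)

    difference-bound : ∀ {G G' u} → 0# ≤ u → ∣ G' + - G ∣ ≤ (G ⊓ G') * u → G ≤ G' + u * G
    difference-bound {G} {G'} {u} 0≤u close = begin
      G                                  ≈⟨ +-identityʳ G ⟨
      G + 0#                             ≤⟨ +-monoʳ-≤ G (-≤∣∣ (G' + - G)) ⟩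
      G + (G' + - G + ∣ G' + - G ∣)
        ≈⟨ trans (solve 4 (λ G G' m d → G :+ (G' :+ m :+ d) := G' :+ d :+ (G :+ m)) refl G G' (- G) _)
                                              (trans (+-congˡ (-‿inverseʳ G)) (+-identityʳ _)) ⟩
      G' + ∣ G' + - G ∣
        ≤⟨ +-monoʳ-≤ G' (≤-trans close (≤-trans (*-monoˡ-≤ 0≤u (⊓≤ˡ G G')) (inj₂ (*-comm G u)))) ⟩
      G' + u * G                         ∎

    log₁₊ : ℕ → ℝ
    log₁₊ x = log₂ (1≤fromℕ[1+n] x)

    1≤log₁₊ : ∀ {x} → 1 ℕ.≤ x → 1# ≤ log₁₊ x
    1≤log₁₊ {x} 1≤x = 1≤log₂ _ (fromℕ-mono-≤ (s≤s 1≤x))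

    log₁₊≤ : ∀ {x y} → 1 ℕ.≤ y → x ℕ.≤ y → log₁₊ x ≤ fromℕ (suc (bitLength (fromℕ y)))
    log₁₊≤ {x} {y} 1≤y x≤y = log₂-< (suc (bitLength (fromℕ y))) _ (begin-strict
      fromℕ (suc x)                 ≤⟨ fromℕ-mono-≤ (ℕ.+-mono-≤ 1≤y x≤y) ⟩
      fromℕ (y ℕ.+ y)               ≈⟨ trans (fromℕ-+ y y) (solve 1 (λ y → y :+ y := numeral 2 :* y) refl (fromℕ y)) ⟩
      2ᴿ * fromℕ y                  <⟨ *-monoʳ-< 0<2 (<2^bitLength (fromℕ y)) ⟩
      2ᴿ ^ℕ suc (bitLength (fromℕ y)) ∎)

    log₁₊-gain : ∀ {x y} → x ℕ.< y → log₁₊ x + 1# ≤ log₁₊ (x ℕ.+ y)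
    log₁₊-gain {x} {y} x<y = log₂-double _ _ (begin
      2ᴿ * fromℕ (suc x)       ≈⟨ fromℕ-* 2 (suc x) ⟨
      fromℕ (2 ℕ.* suc x)      ≤⟨ fromℕ-mono-≤ (ℕ.+-monoʳ-≤ (suc x) (ℕ.≤-trans (ℕ.≤-reflexive (ℕ.+-identityʳ (suc x))) x<y)) ⟩
      fromℕ (suc (x ℕ.+ y))    ∎)

    module _ {η} (0<η : 0# < η) Q (1≤Qη : 1# ≤ fromℕ (suc Q) * η) c (c≡3^Q : c ≡ 3 ℕ.^ suc Q) where

      1≤c : 1 ℕ.≤ c
      1≤c = ≡.subst (1 ℕ.≤_) (≡.sym c≡3^Q) (ℕ.m^n>0 3 (suc Q))

      1≤4c : 1 ℕ.≤ 4 ℕ.* c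
      1≤4c = ℕ.*-mono-≤ {1} {4} (s≤s z≤n) 1≤c

      module _ {x y} (1≤x : 1 ℕ.≤ x) (x<y : x ℕ.< y) where

        private
          K : ℕ
          K = suc (bitLength (fromℕ y))
          F : ℝ
          F = logarithmic (4 ℕ.* c) (fromℕ y)
          1≤cK : 1 ℕ.≤ c ℕ.* K
          1≤cK = ℕ.*-mono-≤ 1≤c (s≤s (z≤n {bitLength (fromℕ y)}))
          0<F : 0# < F
          0<F = 0<logarithmic 1≤4c (fromℕ y)

        -- The calibration of `u = F ⁻¹`: raising `1 + 4u` to the power `suc Q` adds at most
        -- `c * 4u` per unit of `log₁₊ x ≤ K`, in total at most the 1 provided by `log₁₊-gain`.
        4u*cK≈1 : fromℕ 4 * F ⁻¹ * fromℕ (c ℕ.* K) ≈ 1#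
        4u*cK≈1 = begin-equality
          fromℕ 4 * F ⁻¹ * fromℕ (c ℕ.* K)
            ≈⟨ solve 3 (λ f u k → f :* u :* k := f :* k :* u) refl (fromℕ 4) (F ⁻¹) (fromℕ (c ℕ.* K)) ⟩
          fromℕ 4 * fromℕ (c ℕ.* K) * F ⁻¹    ≈⟨ *-congʳ (fromℕ-*-logarithmic 4 c (fromℕ y)) ⟩
          F * F ⁻¹                            ≈⟨ ⁻¹-inverseʳ (0<⇒≉0 0<F) ⟩
          1#                                  ∎

        0≤4u : 0# ≤ fromℕ 4 * F ⁻¹
        0≤4u = 0≤* (0≤fromℕ 4) (inj₁ (0<⁻¹ 0<F))

        4u≤1 : fromℕ 4 * F ⁻¹ ≤ 1#
        4u≤1 = ≤-trans (x≤x*y 0≤4u (1≤fromℕ 1≤cK)) (inj₂ 4u*cK≈1)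

        log₁₊^-gain : (1# + fromℕ 4 * F ⁻¹) * log₁₊ x ^ η ≤ log₁₊ (x ℕ.+ y) ^ η
        log₁₊^-gain = scaled-^ Q (1≤log₁₊ 1≤x) (≤-+ʳ 0≤4u) 0<η 1≤Qη (begin
          (1# + v) ^ℕ suc Q * a
            ≤⟨ *-monoˡ-≤ 0≤a (≡.subst (λ c → (1# + v) ^ℕ suc Q ≤ 1# + fromℕ c * v) (≡.sym c≡3^Q) (binomial-bound (suc Q) 0≤4u 4u≤1)) ⟩
          (1# + fromℕ c * v) * a
            ≈⟨ solve 3 (λ c v a → (con 1 :+ c :* v) :* a := a :+ c :* v :* a) refl (fromℕ c) v a ⟩
          a + fromℕ c * v * a
            ≤⟨ +-monoʳ-≤ a (*-monoʳ-≤ (0≤* (0≤fromℕ c) 0≤4u) (log₁₊≤ (ℕ.≤-trans 1≤x (ℕ.<⇒≤ x<y)) (ℕ.<⇒≤ x<y))) ⟩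
          a + fromℕ c * v * fromℕ K
            ≈⟨ +-congˡ (trans (solve 3 (λ c v k → c :* v :* k := v :* (c :* k)) refl (fromℕ c) v (fromℕ K))
                                                   (trans (*-congˡ (sym (fromℕ-* c K))) 4u*cK≈1)) ⟩
          a + 1#                              ≤⟨ log₁₊-gain x<y ⟩
          log₁₊ (x ℕ.+ y)                     ∎)
          where
          a = log₁₊ x
          v = fromℕ 4 * F ⁻¹
          0≤a : 0# ≤ a
          0≤a = ≤-trans (inj₁ 0<1) (1≤log₁₊ 1≤x)

  open Separation

  -- Upper and lower space bounds at a single period.

  module Intractability (g : ℕ → ℝ) where

    module _ (g∈𝒢 : 𝒢 g) {η} (0<η : 0# < η) where

      private
        0<g : ∀ {x} → 1 ℕ.≤ x → 0# < g x
        0<g {x} = proj₂ (proj₂ g∈𝒢) x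

      0<log^ : ∀ {x} → 1 ℕ.≤ x → 0# < log₁₊ x ^ η
      0<log^ 1≤x = 0<^ (1≤log₁₊ 1≤x) 0<η

      L0≈0 : L η g 0 ≈ 0#
      L0≈0 = trans (*-congʳ (proj₁ g∈𝒢)) (zeroˡ _)

      0<L : ∀ {x} → 1 ℕ.≤ x → 0# < L η g x
      0<L 1≤x = *-pos (0<g 1≤x) (0<log^ 1≤x)

      0≤L : ∀ x → 0# ≤ L η g x
      0≤L zero    = inj₂ (sym L0≈0)
      0≤L (suc x) = inj₁ (0<L (s≤s z≤n))

      -- A witness 0 would put the positive `g y * p` below `g 0 ≈ 0#`. Positivity of `x` is what
      -- makes `log₁₊ x` at least 1.
      period-witness-positive : ∀ {x y p} → 1 ℕ.≤ y → 0# < p → g y * p ≤ g x → 1 ℕ.≤ x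
      period-witness-positive {zero}  1≤y 0<p gyp≤gx =
        contradiction (*-pos (0<g 1≤y) 0<p) (≤⇒≯ (≤-trans gyp≤gx (inj₂ (proj₁ g∈𝒢))))
      period-witness-positive {suc x} _   _   _      = s≤s z≤n

      -- In the application `t` is `n * M` and `P` is `y ^ α`.
      module _ Q (1≤Qη : 1# ≤ fromℕ (suc Q) * η) c (c≡3^Q : c ≡ 3 ℕ.^ suc Q) E (η≤E : η ≤ fromℕ E) {x y t P} k
        (x<y : x ℕ.< y) (y≤t : fromℕ y ≤ t) (0<P : 0# < P) (descent : g y * P ≤ g x)
        (repeat : ∣ g (x ℕ.+ y) + - g x ∣ ≤ (g x ⊓ g (x ℕ.+ y)) * logarithmic (4 ℕ.* c) (fromℕ y) ⁻¹)
        (large : fromℕ (3 ℕ.* k ℕ.* suc (bitLength (fromℕ y)) ℕ.^ E) * logarithmic (4 ℕ.* (4 ℕ.* c)) t ≤ P) where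

        open ≤-Reasoning

        private
          K : ℕ
          K = suc (bitLength (fromℕ y))
          1≤y : 1 ℕ.≤ y
          1≤y = ℕ.≤-trans (s≤s z≤n) x<y
          1≤x : 1 ℕ.≤ x
          1≤x = period-witness-positive 1≤y 0<P descent
          n = 3 ℕ.* k
          D = 4 ℕ.* c
          1≤D : 1 ℕ.≤ D
          1≤D = 1≤4c 0<η Q 1≤Qη c c≡3^Q
          u = logarithmic D (fromℕ y) ⁻¹
          H = logarithmic (4 ℕ.* D) t
          0<F : 0# < logarithmic D (fromℕ y)
          0<F = 0<logarithmic 1≤D (fromℕ y)
          0<H : 0# < H
          0<H = 0<logarithmic (ℕ.*-mono-≤ {1} {4} (s≤s z≤n) 1≤D) t
          ε = H ⁻¹
          0<ε : 0# < ε
          0<ε = 0<⁻¹ 0<H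
          X = L η g x

        -- The accuracy is taken at `t ≥ y`, where `logarithmic` is no smaller, and its constant
        -- carries a further factor 4.
        ε-small : fromℕ 4 * ε ≤ u
        ε-small = ≤-trans (*≤⇒≤/ 0<F (begin
          fromℕ 4 * ε * logarithmic D (fromℕ y)
            ≈⟨ solve 3 (λ a b c → a :* b :* c := a :* c :* b) refl (fromℕ 4) ε (logarithmic D (fromℕ y)) ⟩
          fromℕ 4 * logarithmic D (fromℕ y) * ε    ≈⟨ *-congʳ (fromℕ-*-logarithmic 4 D (fromℕ y)) ⟩
          logarithmic (4 ℕ.* D) (fromℕ y) * ε      ≤⟨ *-monoˡ-≤ (inj₁ 0<ε) (logarithmic-mono-≤ (4 ℕ.* D) y≤t) ⟩
          H * ε                                    ≈⟨ ⁻¹-inverseʳ (0<⇒≉0 0<H) ⟩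
          1#                                       ∎)) (inj₂ (*-identityˡ u))

        4u≤1′ : fromℕ 4 * u ≤ 1#
        4u≤1′ = 4u≤1 0<η Q 1≤Qη c c≡3^Q 1≤x x<y

        gain : (1# + fromℕ 4 * u) * log₁₊ x ^ η ≤ log₁₊ (x ℕ.+ y) ^ η
        gain = log₁₊^-gain 0<η Q 1≤Qη c c≡3^Q 1≤x x<y

        16ε≤1 : fromℕ 16 * ε ≤ 1#
        16ε≤1 = begin
          fromℕ 16 * ε             ≈⟨ trans (*-congʳ (fromℕ-* 4 4)) (*-assoc _ _ _) ⟩
          fromℕ 4 * (fromℕ 4 * ε)  ≤⟨ *-monoʳ-≤ (0≤fromℕ 4) ε-small ⟩
          fromℕ 4 * u              ≤⟨ 4u≤1′ ⟩
          1#                       ∎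

        0≤1-ε : 0# ≤ 1# + - ε
        0≤1-ε = +-cancelʳ-≤ ε (begin
          0# + ε           ≈⟨ +-identityˡ ε ⟩
          ε                ≤⟨ ≤-trans (x≤x*y (inj₁ 0<ε) (1≤fromℕ {16} (s≤s z≤n))) (inj₂ (*-comm _ _)) ⟩
          fromℕ 16 * ε     ≤⟨ 16ε≤1 ⟩
          1#               ≈⟨ trans (+-assoc 1# (- ε) ε) (trans (+-congˡ (-‿inverseˡ ε)) (+-identityʳ 1#)) ⟨
          1# + - ε + ε     ∎)

        -- One factor `1 + ε` allows for the error of the algorithm, the other for the coordinates
        -- that Bob does not query.
        θ : ℝ
        θ = (1# + ε) * ((1# + ε) * X)

        above : θ < (1# + - ε) * L η g (x ℕ.+ y)
        above = relative-gap (0<L 1≤x) 0<ε 16ε≤1 0≤1-ε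
          (product-gap (inj₁ (0<g 1≤x)) (inj₁ (0<g (ℕ.≤-trans 1≤x (ℕ.m≤m+n x y)))) (inj₁ (0<log^ 1≤x))
            (inj₁ (0<⁻¹ 0<F)) 4u≤1′ ε-small (difference-bound (inj₁ (0<⁻¹ 0<F)) repeat) gain)

        -- The logarithmic weight is at most `K ^ E` at `y` and at least 1 at `x`, so the descent of
        -- `g` passes to `L η g` at the cost of `K ^ E`, which `large` covers.
        background : fromℕ n * L η g y ≤ ε * X
        background = ≤-trans (*≤⇒≤/ 0<H (begin
          fromℕ n * (g y * log₁₊ y ^ η) * H        ≤⟨ *-monoˡ-≤ (inj₁ 0<H) (*-monoʳ-≤ (0≤fromℕ n) (*-monoʳ-≤ (inj₁ (0<g 1≤y))
                                                        (^-≤-^ℕ E (1≤log₁₊ 1≤y) 0<η (log₁₊≤ 1≤y ℕ.≤-refl) η≤E))) ⟩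
          fromℕ n * (g y * fromℕ K ^ℕ E) * H
            ≈⟨ solve 4 (λ n g k h → n :* (g :* k) :* h := g :* ((n :* k) :* h)) refl (fromℕ n) (g y) (fromℕ K ^ℕ E) H ⟩
          g y * (fromℕ n * fromℕ K ^ℕ E * H)       ≈⟨ *-congˡ (*-congʳ (trans (fromℕ-* n (K ℕ.^ E)) (*-congˡ (fromℕ-^ K E)))) ⟨
          g y * (fromℕ (n ℕ.* K ℕ.^ E) * H)        ≤⟨ *-monoʳ-≤ (inj₁ (0<g 1≤y)) large ⟩
          g y * P                                  ≤⟨ descent ⟩
          g x                                      ≤⟨ x≤x*y (inj₁ (0<g 1≤x)) (1≤^ (1≤log₁₊ 1≤x) 0<η) ⟩
          X                                        ∎)) (inj₂ (*-comm X ε))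

        below : (1# + ε) * (L η g x + fromℕ n * L η g y) ≤ θ
        below = *-monoʳ-≤ (0≤+ (inj₁ 0<1) (inj₁ 0<ε)) (begin
          X + fromℕ n * L η g y  ≤⟨ +-monoʳ-≤ X background ⟩
          X + ε * X              ≈⟨ solve 2 (λ ε X → X :+ ε :* X := (con 1 :+ ε) :* X) refl ε X ⟩
          (1# + ε) * X           ∎)

        0≤1+ε : 0# ≤ 1# + ε
        0≤1+ε = 0≤+ (inj₁ 0<1) (inj₁ 0<ε)

        L-index-bound : (A : Algorithm 1 n) → (∀ m S → 𝒟 (2 ℕ.* y) m S → SolvesSum (L η g) ε A S) →
          32 ℕ.^ k ℕ.≤ 2 ℕ.^ Algorithm.space A ℕ.* 27 ℕ.^ k
        L-index-bound A = space-bound {k} A L0≈0 0≤L 0≤1+ε 0≤1-ε below above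
          (ℕ.+-mono-≤ (ℕ.<⇒≤ x<y) (ℕ.≤-reflexive (≡.sym (ℕ.+-identityʳ y))))

    -- The smallness assumption says `h < t ^ β`, and `β ≤ 1 / suc B` brings `t ^ β` down to `c`,
    -- which will be `2 ^ i`.
    ℝ-space-bound : ∀ {t β h c} s B → 1# ≤ t → 0# < β → fromℕ (suc B) * β ≤ 1# → t ≤ fromℕ c ^ℕ suc B → 1 ℕ.≤ c →
      fromℕ s ≤ h → ∣ t ^ (- β) * h ∣ < 1# → s ℕ.< c
    ℝ-space-bound {t} {β} {h} {c} s B 1≤t 0<β Bβ≤1 t≤c^B 1≤c s≤h small = fromℕ-cancel-< (begin-strict
      fromℕ s  ≤⟨ s≤h ⟩
      h        <⟨ *-cancelʳ-< (inj₁ (0<⁻¹ 0<t^β)) (begin-strict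
                    h * (t ^ β) ⁻¹       ≈⟨ trans (*-congˡ (sym (^-neg 1≤t 0<β))) (*-comm _ _) ⟩
                    t ^ (- β) * h        ≤⟨ ≤∣∣ _ ⟩
                    ∣ t ^ (- β) * h ∣    <⟨ small ⟩
                    1#                   ≈⟨ ⁻¹-inverseʳ (0<⇒≉0 0<t^β) ⟨
                    t ^ β * (t ^ β) ⁻¹   ∎) ⟩
      t ^ β    ≤⟨ ^-≤-root B 1≤t (1≤fromℕ 1≤c) 0<β Bβ≤1 t≤c^B ⟩
      fromℕ c  ∎)
      where
      open ≤-Reasoning
      0<t^β = 0<^ 1≤t 0<β

  -- Choice of the parameters and the final contradiction.

  module Assembly where

    open Intractability

    module _ {g : ℕ → ℝ} (g∈𝒢 : 𝒢 g) (np : NearlyPeriodic 𝕊 g) {η} (0<η : 0# < η)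
      Q (1≤Qη : 1# ≤ fromℕ (suc Q) * η) c (c≡3^Q : c ≡ 3 ℕ.^ suc Q) E (η≤E : η ≤ fromℕ E)
      {α} (0<α : 0# < α) q (1≤qα : 1# ≤ fromℕ (suc q) * α) where

      open ≤-Reasoning

      private
        -- This is `2 * suc q`: with `1 / suc q ≤ α`, a number `y` of more than `b * i` bits has
        -- `y ^ α ≥ 2 ^ (2 * i)`. It is spelled as a successor to fit `block`.
        b : ℕ
        b = suc (suc (q ℕ.* 2))
        -- `suc B` is the factor in `e≤`, so that `(n * M) ^ β ≤ 2 ^ i` for `β = 1 / suc B`.
        B : ℕ
        B = 5 ℕ.+ (b ℕ.+ b)
        β : ℝ
        β = fromℕ (suc B) ⁻¹
      open Parameters b c E

      module _ {i x y} (1≤i : 1 ℕ.≤ i) (C≤ : C ℕ.* suc i ℕ.^ suc E ℕ.≤ 2 ℕ.^ i)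
        (bi< : b ℕ.* i ℕ.< bitLength (fromℕ y)) (≤b[1+i] : bitLength (fromℕ y) ℕ.≤ b ℕ.* suc i)
        (x<y : x ℕ.< y) (descent : g y * fromℕ y ^ α ≤ g x)
        (repeat : ∣ g (x ℕ.+ y) + - g x ∣ ≤ (g x ⊓ g (x ℕ.+ y)) * logarithmic (4 ℕ.* c) (fromℕ y) ⁻¹) where

        private
          n = domain i
          M = 2 ℕ.* y
          t = fromℕ (n ℕ.* M)
          l = bitLength t
          1≤y : 1 ℕ.≤ y
          1≤y = ℕ.≤-trans (s≤s z≤n) x<y

        y≤t : fromℕ y ≤ t
        y≤t = fromℕ-mono-≤ (y≤domain*2y i y)

        t<2^e : t < 2ᴿ ^ℕ e i
        t<2^e = <-≤-trans (fromℕ-mono-< (domain*2y< {i} {y} (fromℕ-cancel-< (begin-strict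
          fromℕ y                         <⟨ <2^bitLength (fromℕ y) ⟩
          2ᴿ ^ℕ bitLength (fromℕ y)       ≤⟨ ^ℕ-monoʳ-≤ 1≤2 ≤b[1+i] ⟩
          2ᴿ ^ℕ (b ℕ.* suc i)             ≈⟨ fromℕ-^ 2 (b ℕ.* suc i) ⟨
          fromℕ (2 ℕ.^ (b ℕ.* suc i))     ∎)))) (inj₂ (fromℕ-^ 2 (e i)))

        2^2i≤y^α : fromℕ (2 ℕ.^ (i ℕ.+ i)) ≤ fromℕ y ^ α
        2^2i≤y^α = root≤^ (1≤fromℕ 1≤y) 0<α q (0≤fromℕ (2 ℕ.^ (i ℕ.+ i))) 1≤qα (begin
          fromℕ (2 ℕ.^ (i ℕ.+ i)) ^ℕ suc q     ≈⟨ fromℕ-^ (2 ℕ.^ (i ℕ.+ i)) (suc q) ⟨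
          fromℕ ((2 ℕ.^ (i ℕ.+ i)) ℕ.^ suc q)
            ≡⟨ ≡.cong fromℕ (≡.trans (ℕ.^-*-assoc 2 (i ℕ.+ i) (suc q)) (≡.cong (2 ℕ.^_) exponent)) ⟩
          fromℕ (2 ℕ.^ (b ℕ.* i))              ≈⟨ fromℕ-^ 2 (b ℕ.* i) ⟩
          2ᴿ ^ℕ (b ℕ.* i)                      ≤⟨ <bitLength⇒2^≤ (fromℕ y) bi< ⟩
          fromℕ y                              ∎)
          where
          exponent : (i ℕ.+ i) ℕ.* suc q ≡ b ℕ.* i
          exponent = S.solve 2 (λ i q → (i S.:+ i) S.:* (S.con 1 S.:+ q) S.:= (S.con 2 S.:+ q S.:* S.con 2) S.:* i) ≡.refl i q
            where module S = +-*-Solver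

        large : fromℕ (n ℕ.* suc (bitLength (fromℕ y)) ℕ.^ E) * logarithmic (4 ℕ.* (4 ℕ.* c)) t ≤ fromℕ y ^ α
        large = begin
          fromℕ (n ℕ.* suc (bitLength (fromℕ y)) ℕ.^ E) * logarithmic (4 ℕ.* (4 ℕ.* c)) t
            ≈⟨ fromℕ-* (n ℕ.* suc (bitLength (fromℕ y)) ℕ.^ E) (4 ℕ.* (4 ℕ.* c) ℕ.* suc l) ⟨
          fromℕ (n ℕ.* suc (bitLength (fromℕ y)) ℕ.^ E ℕ.* (4 ℕ.* (4 ℕ.* c) ℕ.* suc l))
            ≤⟨ fromℕ-mono-≤ (domain-bound {i} C≤ ≤b[1+i] (<2^⇒bitLength≤ t<2^e)) ⟩
          fromℕ (2 ℕ.^ (i ℕ.+ i))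
            ≤⟨ 2^2i≤y^α ⟩
          fromℕ y ^ α ∎

        space-large : (A : Algorithm 1 n) →
          (∀ m S → 𝒟 M m S → SolvesSum (L η g) (logarithmic (4 ℕ.* (4 ℕ.* c)) t ⁻¹) A S) → 2 ℕ.^ i ℕ.≤ Algorithm.space A
        space-large A solves = index-space (2 ℕ.^ i) (Algorithm.space A)
          (L-index-bound g g∈𝒢 0<η Q 1≤Qη c c≡3^Q E η≤E (5 ℕ.* 2 ℕ.^ i) x<y y≤t (0<^ (1≤fromℕ 1≤y) 0<α) descent repeat large A solves)

        space-small : ∀ {s h} → fromℕ s ≤ h → ∣ t ^ (- β) * h ∣ < 1# → s ℕ.< 2 ℕ.^ i
        space-small {s} = ℝ-space-bound g s B (≤-trans (1≤fromℕ 1≤y) y≤t) (0<⁻¹ (0<fromℕ {suc B} (s≤s z≤n)))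
          (inj₂ (⁻¹-inverseʳ (0<⇒≉0 (0<fromℕ {suc B} (s≤s z≤n))))) (begin
            t                               ≤⟨ inj₁ t<2^e ⟩
            2ᴿ ^ℕ e i                       ≤⟨ ^ℕ-monoʳ-≤ 1≤2 (e≤ 1≤i) ⟩
            2ᴿ ^ℕ (i ℕ.* suc B)             ≈⟨ trans (^-congˡ (suc B) (fromℕ-^ 2 i)) (^-assocʳ 2ᴿ i (suc B)) ⟨
            fromℕ (2 ℕ.^ i) ^ℕ suc B        ∎) (ℕ.m^n>0 2 i)

      private
        accuracy : ℕ → ℕ → ℝ
        accuracy n M = logarithmic (4 ℕ.* (4 ℕ.* c)) (fromℕ (n ℕ.* M)) ⁻¹

        closeness : ℕ → ℝ
        closeness y = logarithmic (4 ℕ.* c) (fromℕ y) ⁻¹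

        Repeats : ℕ → ℕ → Set
        Repeats N₁ y = N₁ ℕ.≤ y → IsPeriod g α y → ∀ x → x ℕ.< y → g y * fromℕ y ^ α ≤ g x →
          ∣ g (x ℕ.+ y) + - g x ∣ ≤ (g x ⊓ g (x ℕ.+ y)) * closeness y

        1≤D : 1 ℕ.≤ 4 ℕ.* c
        1≤D = 1≤4c 0<η Q 1≤Qη c c≡3^Q

        1≤4D : 1 ℕ.≤ 4 ℕ.* (4 ℕ.* c)
        1≤4D = ℕ.*-mono-≤ {1} {4} (s≤s z≤n) 1≤D

      module _ (h* : ℝ≥0 → ℝ) (A : ∀ n M → Algorithm 1 n)
        (A-works : ∀ n M → 1 ℕ.≤ n → 1 ℕ.≤ M → fromℕ (Algorithm.space (A n M)) ≤ h* (fromℕ≥0 (n ℕ.* M)) ×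
          (∀ m S → 𝒟 M m S → SolvesSum (L η g) (accuracy n M) (A n M) S))
        X (h*-small : ∀ t → fromℕ X ≤ proj₁ t → ∣ proj₁ t ^ (- β) * h* t ∣ < 1#)
        N₁ (repeats : ∀ y → Repeats N₁ y) i₀ (C≤ : ∀ i → i₀ ℕ.≤ i → C ℕ.* suc i ℕ.^ suc E ℕ.≤ 2 ℕ.^ i) where

        private
          -- From here on `y` has more than `b * suc i₀` bits, so `block` returns `i > i₀`; this
          -- gives `C≤` at `i` and also `1 ≤ i`.
          N₂ = 2 ℕ.^ (b ℕ.* suc i₀)

        no-period-at : ∀ {i x y} → i₀ ℕ.< i → b ℕ.* i ℕ.< bitLength (fromℕ y) → bitLength (fromℕ y) ℕ.≤ b ℕ.* suc i →
          X ℕ.≤ y → N₁ ℕ.≤ y → x ℕ.< y → ¬ g y ≤ g x / fromℕ y ^ α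
        no-period-at {i} {x} {y} i₀<i bi< ≤b[1+i] X≤y N₁≤y x<y period = ℕ.<⇒≱
          (space-small 1≤i C≤2^i bi< ≤b[1+i] x<y descent repeat (proj₁ (A-works n M (1≤domain i) 1≤M))
            (h*-small (fromℕ≥0 (n ℕ.* M)) (fromℕ-mono-≤ (ℕ.≤-trans X≤y (y≤domain*2y i y)))))
          (space-large 1≤i C≤2^i bi< ≤b[1+i] x<y descent repeat (A n M) (proj₂ (A-works n M (1≤domain i) 1≤M)))
          where
          n = domain i
          M = 2 ℕ.* y
          1≤y : 1 ℕ.≤ y
          1≤y = ℕ.≤-trans (s≤s z≤n) x<y
          1≤M : 1 ℕ.≤ M
          1≤M = ℕ.≤-trans 1≤y (ℕ.m≤m+n y _)
          1≤i : 1 ℕ.≤ i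
          1≤i = ℕ.≤-trans (s≤s z≤n) i₀<i
          C≤2^i = C≤ i (ℕ.<⇒≤ i₀<i)
          descent : g y * fromℕ y ^ α ≤ g x
          descent = ≤/⇒*≤ (0<^ (1≤fromℕ 1≤y) 0<α) period
          repeat : ∣ g (x ℕ.+ y) + - g x ∣ ≤ (g x ⊓ g (x ℕ.+ y)) * closeness y
          repeat = repeats y N₁≤y (x , x<y , period) x x<y descent

        no-period : ∀ y → X ℕ.+ N₁ ℕ.+ N₂ ℕ.≤ y → ¬ IsPeriod g α y
        no-period y N≤y (x , x<y , period) =
          let i , i₀<i , bi< , ≤b[1+i] = block (suc (q ℕ.* 2)) bi₀<
          in no-period-at i₀<i bi< ≤b[1+i] (ℕ.≤-trans (ℕ.m≤m+n X N₁) X+N₁≤y) (ℕ.≤-trans (ℕ.m≤n+m N₁ X) X+N₁≤y) x<y period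
          where
          X+N₁≤y : X ℕ.+ N₁ ℕ.≤ y
          X+N₁≤y = ℕ.≤-trans (ℕ.m≤m+n (X ℕ.+ N₁) N₂) N≤y
          bi₀< : b ℕ.* suc i₀ ℕ.< bitLength (fromℕ y)
          bi₀< = 2^≤⇒<bitLength (≤-trans (inj₂ (sym (fromℕ-^ 2 (b ℕ.* suc i₀))))
            (fromℕ-mono-≤ (ℕ.≤-trans (ℕ.m≤n+m N₂ (X ℕ.+ N₁)) N≤y)))

        unbounded-periods-contradiction : ¬ (∀ N → 0 ℕ.< N → ∃[ y ] N ℕ.≤ y × IsPeriod g α y)
        unbounded-periods-contradiction periods =
          let y , N≤y , period = periods (X ℕ.+ N₁ ℕ.+ N₂)
                (ℕ.≤-trans (ℕ.m^n>0 2 (b ℕ.* suc i₀)) (ℕ.m≤n+m N₂ (X ℕ.+ N₁)))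
          in no-period y N≤y period

      -- The accuracy is fixed first; tractability then yields `h*` and near periodicity `N₁`, and
      -- only afterwards is a period taken beyond all the thresholds, with `n` and `M` read off from
      -- it.
      L-intractable : (∀ N → 0 ℕ.< N → ∃[ y ] N ℕ.≤ y × IsPeriod g α y) → ¬ Tractable 1 (L η g)
      L-intractable periods tractable =
        let h* , h*-sub , A , A-works = tractable
              (λ t → logarithmic (4 ℕ.* (4 ℕ.* c)) (proj₁ t)) (logarithmic-isSubPolynomial 1≤4D proj₁)
              accuracy (λ n M _ _ → inj₂ (sym (⁻¹-inverseˡ (0<logarithmic 1≤4D (fromℕ (n ℕ.* M))))))
            X , small = IsSubPolynomial.x^-αf→0 h*-sub β (0<⁻¹ (0<fromℕ {suc B} (s≤s z≤n))) 1# 0<1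
            X′ , X≤X′ = archimedean X
            N₁ , _ , repeats = NearlyPeriodic.almostRepeats np α 0<α closeness (logarithmic⁻¹∈𝕊 1≤D)
            i₀ , C≤ = polynomial≤2^ C (suc E)
        in unbounded-periods-contradiction h* A A-works X′ (λ t X′≤t → small t (≤-trans X≤X′ X′≤t))
             N₁ repeats i₀ C≤ periods

    L-not-tractable : ∀ {g} → 𝒢 g → NearlyPeriodic 𝕊 g → ∀ {η} → 0# < η → ¬ Tractable 1 (L η g)
    L-not-tractable g∈𝒢 np {η} 0<η =
      let Q , 1≤Qη = reciprocal-bound 0<η
          E , η≤E = archimedean η
          α , 0<α , periods = NearlyPeriodic.unboundedPeriods np
          q , 1≤qα = reciprocal-bound 0<α
      in L-intractable g∈𝒢 np 0<η Q 1≤Qη (3 ℕ.^ suc Q) ≡.refl E η≤E 0<α q 1≤qα periods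

  open Assembly public

theorem30 : (R : CompleteOrderedField) → let open Streaming R in
    (g : ℕ → ℝ) → 𝒢 g → NearlyPeriodic 𝕊 g →
    ¬ Tractable 1 g ⊎ (∀ (η : ℝ) → 0# < η → ¬ Tractable 1 (L η g))
theorem30 R g g∈𝒢 np = inj₂ λ η 0<η → Proof.L-not-tractable R g∈𝒢 np 0<η
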